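{- Let $G$ and $G'$ be graphs on the vertex set $\{1,\dots,n\}$ with adjacency matrices $\Gamma$ and $\Gamma'$ over $\mathbb{F}_2$. Then $G$ and $G'$ are edge-locally equivalent if and only if there exists a diagonal $n\times n$ matrix $A$ over $\mathbb{F}_2$ such that $$(\Gamma'+I)A(\Gamma+I)=\Gamma+\Gamma'.$$ This is a system of $n^2$ affine equations over $\mathbb{F}_2$ in the $n$ diagonal entries of $A$; consequently, edge-local equivalence of two given graphs on $n$ vertices can be decided in $O(n^4)$ time (arithmetic operations in $\mathbb{F}_2$).
   Context: All matrices are over $\mathbb{F}_2$. Graphs are finite, undirected and simple with vertex set $V=\{1,\dots,n\}$; adjacency matrices are symmetric over $\mathbb{F}_2$ with zero diagonal. Local complementation: for a vertex $i$, $G*i$ is the graph on $V$ obtained from $G$ by replacing the subgraph induced on the neighborhood $N(i)$ by its complement and leaving the rest unchanged. For an edge $e=\{i,j\}$ of $G$, the edge-local complement is $G*e=((G*i)*j)*i=((G*j)*i)*j$. Two graphs $G,G'$ on $V$ are edge-locally equivalent if there is a finite (possibly empty) sequence $e_1,\dots,e_N$ of 2-element subsets of $V$ such that $e_1$ is an edge of $G$, $e_\alpha$ is an edge of $((G*e_1)*\dots)*e_{\alpha-1}$ for $\alpha=2,\dots,N$, and $((G*e_1)*\dots)*e_N=G'$. -}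

module Defs where

open import Algebra.Bundles using (CommutativeRing)
import Algebra.Definitions.RawMonoid as RawMonoidDefs
open import Data.Bool.Base using (Bool; true; false; not; if_then_else_; _∧_)
open import Data.Bool.Properties using (xor-∧-commutativeRing; ∧-zeroʳ)
open import Data.Fin.Base using (Fin)
open import Data.Fin.Properties using (_≟_)
open import Data.List.Base using (List; []; _∷_; map; foldl; allFin; length)
open import Data.List.Properties using (≡-dec)
open import Data.Nat.Base as ℕ using (ℕ; suc)
import Data.Nat.Properties as ℕₚ
open import Data.Product.Base using (_×_; _,_; Σ-syntax; ∃-syntax; proj₁; proj₂)
open import Data.Product.Properties using () renaming (≡-dec to ×-≡-dec)
open import Data.Vec.Functional as Vector using (Vector)
open import Function.Bundles using (_⇔_)
open import Relation.Binary.PropositionalEquality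
  using (_≡_; _≢_; refl; sym)
open import Relation.Nullary.Decidable using (yes; no; ⌊_⌋)
open import Relation.Nullary.Negation using (contradiction)

------------------------------------------------------------------------
-- The field 𝔽₂: the ring (Bool, _xor_, _∧_), with 0 = false and 1 = true

open CommutativeRing xor-∧-commutativeRing public
  using (_+_; _*_; 0#; 1#; +-rawMonoid)

open RawMonoidDefs +-rawMonoid public using (sum)

𝔽₂ : Set
𝔽₂ = Bool

------------------------------------------------------------------------
-- Square matrices over 𝔽₂

Matrix : ℕ → Set
Matrix n = Fin n → Fin n → 𝔽₂

infix 4 _≋_
infixl 6 _⊞_
infixl 7 _⊠_

_≋_ : ∀ {n} → Matrix n → Matrix n → Set
M ≋ N = ∀ i j → M i j ≡ N i j

_⊞_ : ∀ {n} → Matrix n → Matrix n → Matrix n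
(M ⊞ N) i j = M i j + N i j

_⊠_ : ∀ {n} → Matrix n → Matrix n → Matrix n
(M ⊠ N) i j = sum (λ k → M i k * N k j)

diag : ∀ {n} → Vector 𝔽₂ n → Matrix n
diag a i j = if ⌊ i ≟ j ⌋ then a i else 0#

I : ∀ {n} → Matrix n
I = diag (λ _ → 1#)

IsDiagonal : ∀ {n} → Matrix n → Set
IsDiagonal A = ∀ i j → i ≢ j → A i j ≡ 0#

IsAffine : ∀ {n} → (Vector 𝔽₂ n → 𝔽₂) → Set
IsAffine {n} f =
  Σ[ c ∈ Vector 𝔽₂ n ] Σ[ b ∈ 𝔽₂ ] (∀ a → f a ≡ sum (λ k → c k * a k) + b)

------------------------------------------------------------------------
-- Graphs

record Graph (n : ℕ) : Set where
  field
    adj       : Matrix n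
    symmetric : ∀ i j → adj i j ≡ adj j i
    loopless  : ∀ i → adj i i ≡ 0#

open Graph public

Edge : ∀ {n} → Graph n → Fin n → Fin n → Set
Edge G i j = adj G i j ≡ 1#

-- Equality of labelled graphs.  Propositional equality of the records would
-- also compare the proof fields and need function extensionality.
infix 4 _≈ᴳ_
_≈ᴳ_ : ∀ {n} → Graph n → Graph n → Set
G ≈ᴳ H = adj G ≋ adj H

-- Whether {i , j} is a pair of distinct neighbours of v.
inNbhd : ∀ {n} → Graph n → Fin n → Fin n → Fin n → Bool
inNbhd G v i j = (adj G v i ∧ adj G v j) ∧ not ⌊ i ≟ j ⌋

private
  inNbhd-sym : ∀ {n} (G : Graph n) v i j → inNbhd G v i j ≡ inNbhd G v j i
  inNbhd-sym G v i j with adj G v i | adj G v j | i ≟ j | j ≟ i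
  ... | false | false | _        | _        = refl
  ... | false | true  | _        | _        = refl
  ... | true  | false | _        | _        = refl
  ... | true  | true  | yes _    | yes _    = refl
  ... | true  | true  | no _     | no _     = refl
  ... | true  | true  | yes i≡j  | no j≢i   = contradiction (sym i≡j) j≢i
  ... | true  | true  | no i≢j   | yes j≡i  = contradiction (sym j≡i) i≢j

  inNbhd-irrefl : ∀ {n} (G : Graph n) v i → inNbhd G v i i ≡ false
  inNbhd-irrefl G v i with i ≟ i
  ... | yes _   = ∧-zeroʳ (adj G v i ∧ adj G v i)
  ... | no  i≢i = contradiction refl i≢i

infixl 8 _⋆_

_⋆_ : ∀ {n} → Graph n → Fin n → Graph n
adj (G ⋆ v) i j = if inNbhd G v i j then not (adj G i j) else adj G i j
symmetric (G ⋆ v) i j rewrite inNbhd-sym G v i j | symmetric G i j = refl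
loopless (G ⋆ v) i rewrite inNbhd-irrefl G v i = loopless G i

-- G * {i , j}.  When {i , j} is an edge, swapping i and j gives the same graph.
edgeLC : ∀ {n} → Graph n → Fin n → Fin n → Graph n
edgeLC G i j = G ⋆ i ⋆ j ⋆ i

data EdgeLocallyEquivalent {n} (G G′ : Graph n) : Set where
  done : G ≈ᴳ G′ → EdgeLocallyEquivalent G G′
  step : ∀ i j → Edge G i j →
         EdgeLocallyEquivalent (edgeLC G i j) G′ → EdgeLocallyEquivalent G G′

------------------------------------------------------------------------
-- Running time
--
-- Time is measured on programs of a small imperative language.  A program
-- is a single finite text, independent of n; it computes on arrays with
-- entries in 𝔽₂, and its only loops are "for i = 0 , … , n - 1".  Array
-- subscripts are loop variables, so the language has no arithmetic on
-- integers (or unbounded words) that could hide work in a unit-cost step: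
-- each arithmetic operation of 𝔽₂, each memory access, each test and each
-- loop iteration is charged.

-- An array cell: the name of the array and its list of subscripts, each one
-- of the k loop variables in scope (de Bruijn, innermost loop first).
-- Scalars are arrays without subscripts.
Cell : ℕ → Set
Cell k = ℕ × List (Fin k)

data Expr (k : ℕ) : Set where
  lit       : 𝔽₂ → Expr k
  read      : Cell k → Expr k
  add mul   : Expr k → Expr k → Expr k

infix  5 _≔_
infixr 4 _⨾_

data Cmd (k : ℕ) : Set where
  skip : Cmd k
  _≔_  : Cell k → Expr k → Cmd k
  _⨾_  : Cmd k → Cmd k → Cmd k
  cond : Expr k → Cmd k → Cmd k → Cmd k
  for  : Cmd (suc k) → Cmd k

Program : Set
Program = Cmd 0

module Semantics (n : ℕ) where

  Env : ℕ → Set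
  Env k = Vector (Fin n) k

  Address : Set
  Address = ℕ × List (Fin n)

  Memory : Set
  Memory = Address → 𝔽₂

  address : ∀ {k} → Env k → Cell k → Address
  address ρ (x , is) = x , map ρ is

  write : Address → 𝔽₂ → Memory → Memory
  write p v m q = if ⌊ ×-≡-dec ℕₚ._≟_ (≡-dec _≟_) p q ⌋ then v else m q

  eval : ∀ {k} → Env k → Memory → Expr k → 𝔽₂
  eval ρ m (lit v)   = v
  eval ρ m (read c)  = m (address ρ c)
  eval ρ m (add e f) = eval ρ m e + eval ρ m f
  eval ρ m (mul e f) = eval ρ m e * eval ρ m f

  accessCost : ∀ {k} → Cell k → ℕ
  accessCost (_ , is) = suc (length is)

  evalCost : ∀ {k} → Expr k → ℕ
  evalCost (lit _)   = 1
  evalCost (read c)  = accessCost c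
  evalCost (add e f) = suc (evalCost e ℕ.+ evalCost f)
  evalCost (mul e f) = suc (evalCost e ℕ.+ evalCost f)

  -- Memory together with the time elapsed so far.
  State : Set
  State = Memory × ℕ

  tick : ℕ → State → State
  tick d (m , t) = m , t ℕ.+ d

  exec : ∀ {k} → Cmd k → Env k → State → State
  exec skip         ρ s       = tick 1 s
  exec (c ≔ e)      ρ (m , t) =
    write (address ρ c) (eval ρ m e) m , t ℕ.+ (accessCost c ℕ.+ evalCost e)
  exec (p ⨾ q)      ρ s       = exec q ρ (exec p ρ s)
  exec (cond e p q) ρ (m , t) =
    let s = (m , t ℕ.+ suc (evalCost e)) in
    if eval ρ m e then exec p ρ s else exec q ρ s
  exec (for p)      ρ s       =
    foldl (λ s′ i → exec p (i Vector.∷ ρ) (tick 1 s′)) (tick 1 s) (allFin n)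

  -- The inputs are the two-dimensional arrays 0 and 1; everything else is 0.
  initial : Graph n → Graph n → Memory
  initial G G′ (0 , i ∷ j ∷ []) = adj G i j
  initial G G′ (1 , i ∷ j ∷ []) = adj G′ i j
  initial G G′ _                = 0#

  run : Program → Graph n → Graph n → State
  run p G G′ = exec p Vector.[] (initial G G′ , 0)

  -- The answer is left in the scalar 2.
  output : Program → Graph n → Graph n → 𝔽₂
  output p G G′ = proj₁ (run p G G′) (2 , [])

  time : Program → Graph n → Graph n → ℕ
  time p G G′ = proj₂ (run p G G′)

open Semantics public using (output; time)

DecidableInTimeO : (∀ {n} → Graph n → Graph n → Set) → (ℕ → ℕ) → Set
DecidableInTimeO R f =
  ∃[ p ] (∀ n (G G′ : Graph n) → output n p G G′ ≡ 1# ⇔ R G G′)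
       × ∃[ c ] ∃[ n₀ ] (∀ n → n₀ ℕ.≤ n → ∀ (G G′ : Graph n) →
                           time n p G G′ ℕ.≤ c ℕ.* f n)

{-# OPTIONS --safe #-}

-- Over the graph subspace L = {(x , Γx)}, the equation (Γ′+I)A(Γ+I) = Γ+Γ′ with
-- A = diag a says that exchanging the coordinates x_k and y_k for all k with
-- a_k = 1 carries L to L′.  Such exchanges compose by adding the vectors a, and
-- an edge-local complementation along {i , j} is the exchange at i and j.
-- Conversely, if a_i = 1 then i has a neighbour j with a_j = 1, and
-- complementing along {i , j} removes both from the support of a.
--
-- For the running time, the n² equations are imposed one after another on an
-- affine space p + span (V_k), stored as n + 1 vectors: if some V_k violates the
-- homogeneous equation, one such V_k is added to all other offending vectors and
-- to itself, and also to p if p violates the equation.  This costs O(n²) per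
-- equation.  The final p is a solution whenever there is one, so it is enough to
-- test p.
module Submission where

open import Defs
open import Algebra.Bundles using (CommutativeRing)
import Algebra.Properties.Semiring.Sum as SemiringSum
open import Data.Bool.Base using (Bool; true; false; if_then_else_; _∨_)
open import Data.Bool.Properties
  using (xor-∧-commutativeRing; xor-same; xor-comm; xor-assoc; xor-identityʳ;
         ∧-comm; ∧-assoc; ∧-identityʳ; ∧-zeroʳ; ¬-not)
  renaming (_≟_ to _≟ᵇ_)
open import Data.Bool.Solver using (module xor-∧-Solver)
open import Data.Fin.Base using (Fin; zero; suc; toℕ)
open import Data.Fin.Patterns using (0F; 1F; 2F; 3F)
open import Data.Fin.Properties using (_≟_; any?; toℕ-injective; toℕ<n)
open import Data.List.Base using ([]; _∷_; allFin; foldl; length; tabulate; map)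
open import Data.List.Membership.Propositional using (_∈_)
open import Data.List.Membership.Propositional.Properties using (∈-allFin)
open import Data.List.Properties using (≡-dec; length-tabulate)
open import Data.List.Relation.Unary.Any using (here; there)
open import Data.Nat.Base as ℕ using (ℕ; zero; suc; _^_; _≤_; NonZero; _⊔_; _<ᵇ_; _≡ᵇ_)
import Data.Nat.Properties as ℕₚ
open import Data.Product.Base using (_×_; _,_; ∃-syntax; proj₁; proj₂)
open import Data.Product.Properties using (,-injectiveˡ) renaming (≡-dec to ×-≡-dec)
open import Data.Sum.Base using (_⊎_; inj₁; inj₂)
open import Data.Unit.Base using (⊤; tt)
open import Data.Vec.Functional as Vector using (Vector)
open import Function.Base using (_∘_; id)
open import Function.Bundles using (_⇔_; mk⇔)
open import Relation.Binary.PropositionalEquality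
open import Relation.Nullary.Decidable using (Dec; yes; no; _×-dec_)
open import Relation.Nullary.Negation using (contradiction)

open CommutativeRing xor-∧-commutativeRing using (semiring)
open SemiringSum semiring
  using (sum-cong-≗; sum-replicate-zero; ∑-distrib-+; ∑-comm; *-distribˡ-sum; *-distribʳ-sum)
open xor-∧-Solver using (solve; _:+_; _:*_; _:=_; con)

private variable
  k n : ℕ

-- Matrices over 𝔽₂

x+y≡0⇒x≡y : ∀ x y → x + y ≡ 0# → x ≡ y
x+y≡0⇒x≡y false false _ = refl
x+y≡0⇒x≡y true  true  _ = refl

I-diag : (i : Fin n) → I i i ≡ 1#
I-diag i with i ≟ i
... | yes _   = refl
... | no  i≢i = contradiction refl i≢i

I-off : {i j : Fin n} → i ≢ j → I i j ≡ 0#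
I-off {i = i} {j} i≢j with i ≟ j
... | yes i≡j = contradiction i≡j i≢j
... | no  _   = refl

I-sym : (i j : Fin n) → I i j ≡ I j i
I-sym i j with i ≟ j
... | yes refl = sym (I-diag i)
... | no  i≢j  = sym (I-off (i≢j ∘ sym))

I-suc : (i j : Fin n) → I (suc i) (suc j) ≡ I i j
I-suc i j with i ≟ j
... | yes _ = refl
... | no  _ = refl

I-*-transport : (i j : Fin n) (f : Fin n → 𝔽₂) → I i j * f j ≡ I i j * f i
I-*-transport i j f with i ≟ j
... | yes refl = refl
... | no  _    = refl

sum-zero : {f : Vector 𝔽₂ n} → (∀ k → f k ≡ 0#) → sum f ≡ 0#
sum-zero {n} f≡0 = trans (sum-cong-≗ f≡0) (sum-replicate-zero n)

sum-I : (i : Fin n) (f : Vector 𝔽₂ n) → sum (λ k → I i k * f k) ≡ f i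
sum-I {suc n} zero    f =
  trans (cong (f zero +_) (sum-zero {f = λ k → I zero (suc k) * f (suc k)} λ k → refl)) (xor-identityʳ (f zero))
sum-I {suc n} (suc i) f =
  trans (sum-cong-≗ λ k → cong (_* f (suc k)) (I-suc i k)) (sum-I i (f ∘ suc))

sum-+-cong : {f g h : Vector 𝔽₂ n} → (∀ k → f k ≡ g k + h k) → sum f ≡ sum g + sum h
sum-+-cong {g = g} {h} f≡g+h = trans (sum-cong-≗ f≡g+h) (∑-distrib-+ g h)

⊠-congˡ : (M : Matrix n) {N N′ : Matrix n} → N ≋ N′ → M ⊠ N ≋ M ⊠ N′
⊠-congˡ M N≋N′ i j = sum-cong-≗ λ k → cong (M i k *_) (N≋N′ k j)

⊠-congʳ : {M M′ : Matrix n} (N : Matrix n) → M ≋ M′ → M ⊠ N ≋ M′ ⊠ N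
⊠-congʳ N M≋M′ i j = sum-cong-≗ λ k → cong (_* N k j) (M≋M′ i k)

⊠-assoc : (L M N : Matrix n) → L ⊠ M ⊠ N ≋ L ⊠ (M ⊠ N)
⊠-assoc L M N i j = begin
  sum (λ k → sum (λ l → L i l * M l k) * N k j)
    ≡⟨ sum-cong-≗ (λ k → *-distribʳ-sum (N k j) (λ l → L i l * M l k)) ⟩
  sum (λ k → sum (λ l → L i l * M l k * N k j))
    ≡⟨ ∑-comm (λ k l → L i l * M l k * N k j) ⟩
  sum (λ l → sum (λ k → L i l * M l k * N k j))
    ≡⟨ sum-cong-≗ (λ l → trans (sum-cong-≗ λ k → ∧-assoc (L i l) (M l k) (N k j))
                               (sym (*-distribˡ-sum (L i l) (λ k → M l k * N k j)))) ⟩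
  sum (λ l → L i l * sum (λ k → M l k * N k j)) ∎
  where open ≡-Reasoning

⊠-distribˡ-⊞ : (L M N : Matrix n) → L ⊠ (M ⊞ N) ≋ L ⊠ M ⊞ L ⊠ N
⊠-distribˡ-⊞ L M N i j = sum-+-cong λ k →
  solve 3 (λ x y z → x :* (y :+ z) := x :* y :+ x :* z) refl (L i k) (M k j) (N k j)

⊠-distribʳ-⊞ : (L M N : Matrix n) → (L ⊞ M) ⊠ N ≋ L ⊠ N ⊞ M ⊠ N
⊠-distribʳ-⊞ L M N i j = sum-+-cong λ k →
  solve 3 (λ x y z → (x :+ y) :* z := x :* z :+ y :* z) refl (L i k) (M i k) (N k j)

-- For diagonal `A` only the term `l = k` of the inner sum survives, so the product is linear in the
-- entries `A k k`.
⊠-diagonal : (M A N : Matrix n) → IsDiagonal A →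
             ∀ i j → (M ⊠ A ⊠ N) i j ≡ sum (λ k → M i k * N k j * A k k)
⊠-diagonal M A N A-diagonal i j = sum-cong-≗ λ k → begin
  sum (λ l → M i l * A l k) * N k j
    ≡⟨ cong (_* N k j) (sum-cong-≗ (concentrate k)) ⟩
  sum (λ l → I k l * (M i l * A l k)) * N k j
    ≡⟨ cong (_* N k j) (sum-I k (λ l → M i l * A l k)) ⟩
  M i k * A k k * N k j
    ≡⟨ solve 3 (λ x y z → x :* y :* z := x :* z :* y) refl (M i k) (A k k) (N k j) ⟩
  M i k * N k j * A k k ∎
  where
  open ≡-Reasoning
  concentrate : ∀ k l → M i l * A l k ≡ I k l * (M i l * A l k)
  concentrate k l with k ≟ l
  ... | yes refl = refl
  ... | no  k≢l  = trans (cong (M i l *_) (A-diagonal l k (k≢l ∘ sym))) (∧-zeroʳ (M i l))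

diag-isDiagonal : (a : Vector 𝔽₂ n) → IsDiagonal (diag a)
diag-isDiagonal a i j i≢j with i ≟ j
... | yes i≡j = contradiction i≡j i≢j
... | no  _   = refl

diag-diag : (a : Vector 𝔽₂ n) → ∀ i → diag a i i ≡ a i
diag-diag a i with i ≟ i
... | yes _   = refl
... | no  i≢i = contradiction refl i≢i

⊠-diag : (M N : Matrix n) (a : Vector 𝔽₂ n) →
         ∀ i j → (M ⊠ diag a ⊠ N) i j ≡ sum (λ k → M i k * N k j * a k)
⊠-diag M N a i j = trans (⊠-diagonal M (diag a) N (diag-isDiagonal a) i j)
  (sum-cong-≗ λ k → cong (M i k * N k j *_) (diag-diag a k))

-- The matrix equation as the composition of exchanges

-- The factor of the unknown `a k` in the equation at entry (i, j), in the form produced by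
-- `⊠-diagonal`.
coefficient : Graph n → Graph n → Fin n → Fin n → Vector 𝔽₂ n
coefficient G G′ i j k = (adj G′ ⊞ I) i k * (adj G ⊞ I) k j

-- The matrix equation for `diag a`, entry by entry. Being a record, it lets `a`, `G` and `G′` be
-- inferred from a proof.
record Exchanges (a : Vector 𝔽₂ n) (G G′ : Graph n) : Set where
  field solves : ∀ i j → sum (λ k → coefficient G G′ i j k * a k) ≡ adj G i j + adj G′ i j

open Exchanges public

exchanges⇒matrix : {a : Vector 𝔽₂ n} {G G′ : Graph n} → Exchanges a G G′ →
                   (adj G′ ⊞ I) ⊠ diag a ⊠ (adj G ⊞ I) ≋ adj G ⊞ adj G′
exchanges⇒matrix {a = a} {G} {G′} e i j = trans (⊠-diag (adj G′ ⊞ I) (adj G ⊞ I) a i j) (solves e i j)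

matrix⇒exchanges : {A : Matrix n} {G G′ : Graph n} → IsDiagonal A →
                   (adj G′ ⊞ I) ⊠ A ⊠ (adj G ⊞ I) ≋ adj G ⊞ adj G′ →
                   Exchanges (λ k → A k k) G G′
matrix⇒exchanges {A = A} {G} {G′} A-diagonal eq .solves i j =
  trans (sym (⊠-diagonal (adj G′ ⊞ I) A (adj G ⊞ I) A-diagonal i j)) (eq i j)

exchanges-zero : {a : Vector 𝔽₂ n} {G G′ : Graph n} → (∀ k → a k ≡ 0#) →
                 Exchanges a G G′ → G ≈ᴳ G′
exchanges-zero {a = a} {G} {G′} a≡0 e i j = x+y≡0⇒x≡y _ _ (trans (sym (solves e i j))
  (sum-zero λ k → trans (cong (coefficient G G′ i j k *_) (a≡0 k)) (∧-zeroʳ _)))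

exchanges-refl : {G G′ : Graph n} → G ≈ᴳ G′ → Exchanges (λ _ → 0#) G G′
exchanges-refl {G = G} {G′} G≈G′ .solves i j =
  trans (sum-zero λ k → ∧-zeroʳ (coefficient G G′ i j k))
        (sym (trans (cong (adj G i j +_) (sym (G≈G′ i j))) (xor-same (adj G i j))))

-- Transposition swaps the roles of `G` and `G′`, because both adjacency matrices and `diag a` are
-- symmetric.
exchanges-sym : {a : Vector 𝔽₂ n} {G G′ : Graph n} → Exchanges a G G′ → Exchanges a G′ G
exchanges-sym {a = a} {G} {G′} e .solves i j = begin
  sum (λ k → (adj G i k + I i k) * (adj G′ k j + I k j) * a k)
    ≡⟨ sum-cong-≗ (λ k → cong (_* a k) (trans
         (cong₂ _*_ (cong₂ _+_ (symmetric G i k) (I-sym i k))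
                    (cong₂ _+_ (symmetric G′ k j) (I-sym k j)))
         (∧-comm (adj G k i + I k i) _))) ⟩
  sum (λ k → coefficient G G′ j i k * a k)
    ≡⟨ solves e j i ⟩
  adj G j i + adj G′ j i
    ≡⟨ cong₂ _+_ (symmetric G j i) (symmetric G′ j i) ⟩
  adj G i j + adj G′ i j
    ≡⟨ xor-comm (adj G i j) (adj G′ i j) ⟩
  adj G′ i j + adj G i j ∎
  where open ≡-Reasoning

-- From P′AP = P + P′ and P″BP′ = P′ + P″ one gets
-- P″AP = P′AP + P″BP′AP = P + P′ + P″B(P + P′) = P + P″ + P″BP.
exchanges-trans : {a b : Vector 𝔽₂ n} {G G′ G″ : Graph n} →
                  Exchanges a G G′ → Exchanges b G′ G″ →
                  Exchanges (λ k → a k + b k) G G″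
exchanges-trans {a = a} {b} {G} {G′} {G″} e f .solves i j = begin
  sum (λ k → coefficient G G″ i j k * (a k + b k))
    ≡⟨ sum-+-cong (λ k → solve 3 (λ x y z → x :* (y :+ z) := x :* y :+ x :* z) refl
                           (coefficient G G″ i j k) (a k) (b k)) ⟩
  sum (λ k → coefficient G G″ i j k * a k) + sum (λ k → coefficient G G″ i j k * b k)
    ≡⟨ cong₂ _+_ (⊠-diag P″ P a i j) (⊠-diag P″ P b i j) ⟨
  (P″ ⊠ A ⊠ P) i j + (P″ ⊠ B ⊠ P) i j
    ≡⟨ cong (_+ (P″ ⊠ B ⊠ P) i j) P″AP ⟩
  adj G i j + adj G′ i j + ((P″ ⊠ B ⊠ P) i j + (adj G′ i j + adj G″ i j)) + (P″ ⊠ B ⊠ P) i j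
    ≡⟨ solve 4 (λ x y z t → x :+ y :+ (t :+ (y :+ z)) :+ t := x :+ z) refl
         (adj G i j) (adj G′ i j) (adj G″ i j) ((P″ ⊠ B ⊠ P) i j) ⟩
  adj G i j + adj G″ i j ∎
  where
  open ≡-Reasoning
  P  = adj G  ⊞ I
  P′ = adj G′ ⊞ I
  P″ = adj G″ ⊞ I
  A  = diag a
  B  = diag b

  ⊞-cancel-I : ∀ (H H′ : Graph _) → adj H ⊞ adj H′ ≋ (adj H ⊞ I) ⊞ (adj H′ ⊞ I)
  ⊞-cancel-I H H′ i j = solve 3 (λ x y z → x :+ y := (x :+ z) :+ (y :+ z)) refl
                          (adj H i j) (adj H′ i j) (I i j)

  P′AP : P′ ⊠ A ⊠ P ≋ P ⊞ P′
  P′AP i j = trans (exchanges⇒matrix e i j) (⊞-cancel-I G G′ i j)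

  P″BP′ : P″ ⊠ B ⊠ P′ ≋ P′ ⊞ P″
  P″BP′ i j = trans (exchanges⇒matrix f i j) (⊞-cancel-I G′ G″ i j)

  P″-split : P″ ≋ P′ ⊞ P″ ⊠ B ⊠ P′
  P″-split i j = trans (solve 2 (λ x y → y := x :+ (x :+ y)) refl (P′ i j) (P″ i j))
                       (cong (P′ i j +_) (sym (P″BP′ i j)))

  P″AP : (P″ ⊠ A ⊠ P) i j ≡
         adj G i j + adj G′ i j + ((P″ ⊠ B ⊠ P) i j + (adj G′ i j + adj G″ i j))
  P″AP = begin
    (P″ ⊠ A ⊠ P) i j
      ≡⟨ ⊠-assoc P″ A P i j ⟩
    (P″ ⊠ (A ⊠ P)) i j
      ≡⟨ ⊠-congʳ (A ⊠ P) P″-split i j ⟩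
    ((P′ ⊞ P″ ⊠ B ⊠ P′) ⊠ (A ⊠ P)) i j
      ≡⟨ ⊠-distribʳ-⊞ P′ (P″ ⊠ B ⊠ P′) (A ⊠ P) i j ⟩
    (P′ ⊠ (A ⊠ P)) i j + (P″ ⊠ B ⊠ P′ ⊠ (A ⊠ P)) i j
      ≡⟨ cong₂ _+_ (trans (sym (⊠-assoc P′ A P i j)) (exchanges⇒matrix e i j)) (begin
           (P″ ⊠ B ⊠ P′ ⊠ (A ⊠ P)) i j     ≡⟨ ⊠-assoc (P″ ⊠ B) P′ (A ⊠ P) i j ⟩
           (P″ ⊠ B ⊠ (P′ ⊠ (A ⊠ P))) i j   ≡⟨ ⊠-congˡ (P″ ⊠ B) (λ i j → trans (sym (⊠-assoc P′ A P i j)) (P′AP i j)) i j ⟩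
           (P″ ⊠ B ⊠ (P ⊞ P′)) i j         ≡⟨ ⊠-distribˡ-⊞ (P″ ⊠ B) P P′ i j ⟩
           (P″ ⊠ B ⊠ P) i j + (P″ ⊠ B ⊠ P′) i j
             ≡⟨ cong ((P″ ⊠ B ⊠ P) i j +_) (exchanges⇒matrix f i j) ⟩
           (P″ ⊠ B ⊠ P) i j + (adj G′ i j + adj G″ i j) ∎) ⟩
    adj G i j + adj G′ i j + ((P″ ⊠ B ⊠ P) i j + (adj G′ i j + adj G″ i j)) ∎

-- Edge-local complementation as an exchange

-- Toggling an entry is adding 1, and the factor `1# + I a b` spares the diagonal. Local
-- complementation thus becomes polynomial in the entries.
⋆-adj : (G : Graph n) (v a b : Fin n) →
        adj (G ⋆ v) a b ≡ adj G a b + adj G v a * adj G v b * (1# + I a b)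
⋆-adj G v a b with adj G v a | adj G v b | adj G a b | a ≟ b
... | false | _     | false | _     = refl
... | false | _     | true  | _     = refl
... | true  | false | false | _     = refl
... | true  | false | true  | _     = refl
... | true  | true  | false | yes _ = refl
... | true  | true  | true  | yes _ = refl
... | true  | true  | false | no _  = refl
... | true  | true  | true  | no _  = refl

module EdgeLC (G : Graph n) (i j : Fin n) (ij : Edge G i j) where

  P : Matrix n
  P = adj G ⊞ I

  i≢j : i ≢ j
  i≢j refl = contradiction (trans (sym ij) (loopless G i)) λ ()

  ji : Edge G j i
  ji = trans (symmetric G j i) ij

  P-diag : ∀ k → P k k ≡ 1#
  P-diag k = cong₂ _+_ (loopless G k) (I-diag k)

  Pij : P i j ≡ 1#
  Pij = cong₂ _+_ ij (I-off i≢j)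

  Pji : P j i ≡ 1#
  Pji = cong₂ _+_ ji (I-off (i≢j ∘ sym))

  H K : Graph n
  H = G ⋆ i
  K = H ⋆ j

  Hi : ∀ b → adj H i b ≡ adj G i b
  Hi b = trans (⋆-adj G i i b) (trans
    (cong (λ x → adj G i b + x * adj G i b * (1# + I i b)) (loopless G i))
    (xor-identityʳ _))

  -- As i is adjacent to j, complementing at i adds row i to row j. The entry at j is exempt from
  -- toggling; the identity contained in `P` makes up for it.
  Hj : ∀ b → adj H j b ≡ P j b + adj G i b
  Hj b = begin
    adj H j b
      ≡⟨ ⋆-adj G i j b ⟩
    adj G j b + adj G i j * adj G i b * (1# + I j b)
      ≡⟨ cong (λ x → adj G j b + x * adj G i b * (1# + I j b)) ij ⟩
    adj G j b + adj G i b * (1# + I j b)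
      ≡⟨ solve 3 (λ x y z → x :+ y :* (con 1# :+ z) := x :+ y :+ z :* y) refl
           (adj G j b) (adj G i b) (I j b) ⟩
    adj G j b + adj G i b + I j b * adj G i b
      ≡⟨ cong (λ x → adj G j b + adj G i b + x)
           (trans (I-*-transport j b (adj G i)) (trans (cong (I j b *_) ij) (∧-identityʳ _))) ⟩
    adj G j b + adj G i b + I j b
      ≡⟨ solve 3 (λ x y z → x :+ y :+ z := x :+ z :+ y) refl
           (adj G j b) (adj G i b) (I j b) ⟩
    adj G j b + I j b + adj G i b ∎
    where open ≡-Reasoning

  Hji : adj H j i ≡ 1#
  Hji = trans (Hj i) (cong₂ _+_ Pji (loopless G i))

  -- Complementing at j adds row j of `H` to row i, which cancels the old row: i takes over the
  -- neighbours of j, while i and j stay adjacent.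
  Ki : ∀ b → adj K i b ≡ P j b + I i b
  Ki b = begin
    adj K i b
      ≡⟨ ⋆-adj H j i b ⟩
    adj H i b + adj H j i * adj H j b * (1# + I i b)
      ≡⟨ cong₂ (λ x y → x + y * adj H j b * (1# + I i b)) (Hi b) Hji ⟩
    adj G i b + adj H j b * (1# + I i b)
      ≡⟨ solve 3 (λ x y z → x :+ y :* (con 1# :+ z) := x :+ y :+ z :* y) refl
           (adj G i b) (adj H j b) (I i b) ⟩
    adj G i b + adj H j b + I i b * adj H j b
      ≡⟨ cong₂ (λ x y → adj G i b + x + y) (Hj b)
           (trans (I-*-transport i b (adj H j)) (trans (cong (I i b *_) Hji) (∧-identityʳ _))) ⟩
    adj G i b + (P j b + adj G i b) + I i b
      ≡⟨ solve 3 (λ x y z → x :+ (y :+ x) :+ z := y :+ z) refl (adj G i b) (P j b) (I i b) ⟩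
    P j b + I i b ∎
    where open ≡-Reasoning

  -- The graph changes by the two outer products of the rows of `P` at i and j. Off the diagonal the
  -- three complementations are expanded in turn; on it both sides vanish.
  edgeLC-adj : ∀ a b → adj (edgeLC G i j) a b ≡ adj G a b + P i a * P j b + P j a * P i b
  edgeLC-adj a b = by-cases (a ≟ b)
   where
   by-cases : Dec (a ≡ b) → adj (edgeLC G i j) a b ≡ adj G a b + P i a * P j b + P j a * P i b
   by-cases (yes refl) = trans (loopless (edgeLC G i j) a)
           (sym (trans (cong (λ x → x + P i a * P j a + P j a * P i a) (loopless G a))
                       (solve 2 (λ x y → x :* y :+ y :* x := con 0#) refl (P i a) (P j a))))
   by-cases (no a≢b) = begin
     adj (K ⋆ i) a b
       ≡⟨ off K i ⟩
     adj K a b + adj K i a * adj K i b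
       ≡⟨ cong₂ _+_ (off H j) (cong₂ _*_ (Ki a) (Ki b)) ⟩
     adj H a b + adj H j a * adj H j b + (P j a + I i a) * (P j b + I i b)
       ≡⟨ cong (_+ (P j a + I i a) * (P j b + I i b))
               (cong₂ _+_ (off G i) (cong₂ _*_ (Hj a) (Hj b))) ⟩
     adj G a b + adj G i a * adj G i b + (P j a + adj G i a) * (P j b + adj G i b)
       + (P j a + I i a) * (P j b + I i b)
       ≡⟨ solve 7 (λ g x y p q d e →
              g :+ x :* y :+ (p :+ x) :* (q :+ y) :+ (p :+ d) :* (q :+ e)
                := g :+ (x :+ d) :* q :+ p :* (y :+ e) :+ d :* e) refl
            (adj G a b) (adj G i a) (adj G i b) (P j a) (P j b) (I i a) (I i b) ⟩
     adj G a b + P i a * P j b + P j a * P i b + I i a * I i b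
       -- The leftover `I i a * I i b` is nonzero only if a = i = b.
       ≡⟨ cong (adj G a b + P i a * P j b + P j a * P i b +_) disjoint ⟩
     adj G a b + P i a * P j b + P j a * P i b + 0#
       ≡⟨ xor-identityʳ _ ⟩
     adj G a b + P i a * P j b + P j a * P i b ∎
     where
     open ≡-Reasoning
     off : ∀ (L : Graph n) v → adj (L ⋆ v) a b ≡ adj L a b + adj L v a * adj L v b
     off L v = trans (⋆-adj L v a b) (cong (adj L a b +_)
       (trans (cong (λ x → adj L v a * adj L v b * (1# + x)) (I-off a≢b)) (∧-identityʳ _)))
     disjoint : I i a * I i b ≡ 0#
     disjoint with i ≟ a
     ... | yes refl = I-off a≢b
     ... | no  _    = refl

  edge : Vector 𝔽₂ n
  edge k = I i k + I j k

  -- Only k = i and k = j contribute, and columns i and j of `P` trade places in the new graph. The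
  -- two remaining terms are the outer products of `edgeLC-adj`.
  edgeLC-exchanges : Exchanges edge G (edgeLC G i j)
  edgeLC-exchanges .solves a b = begin
    sum (λ k → coefficient G M a b k * (I i k + I j k))
      ≡⟨ sum-+-cong (λ k → solve 3 (λ x y z → x :* (y :+ z) := y :* x :+ z :* x) refl
                             (coefficient G M a b k) (I i k) (I j k)) ⟩
    sum (λ k → I i k * coefficient G M a b k) + sum (λ k → I j k * coefficient G M a b k)
      ≡⟨ cong₂ _+_ (sum-I i (coefficient G M a b)) (sum-I j (coefficient G M a b)) ⟩
    (adj M a i + I a i) * P i b + (adj M a j + I a j) * P j b
      ≡⟨ cong₂ (λ x y → x * P i b + y * P j b) column-i column-j ⟩
    P j a * P i b + P i a * P j b
      ≡⟨ solve 3 (λ x y z → y :+ x := z :+ (z :+ x :+ y)) refl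
           (P i a * P j b) (P j a * P i b) (adj G a b) ⟩
    adj G a b + (adj G a b + P i a * P j b + P j a * P i b)
      ≡⟨ cong (adj G a b +_) (edgeLC-adj a b) ⟨
    adj G a b + adj M a b ∎
    where
    open ≡-Reasoning
    M = edgeLC G i j
    column-i : adj M a i + I a i ≡ P j a
    column-i = begin
      adj M a i + I a i
        ≡⟨ cong (_+ I a i) (edgeLC-adj a i) ⟩
      adj G a i + P i a * P j i + P j a * P i i + I a i
        ≡⟨ cong₂ (λ x y → adj G a i + P i a * x + P j a * y + I a i) Pji (P-diag i) ⟩
      adj G a i + P i a * 1# + P j a * 1# + I a i
        ≡⟨ cong₂ (λ x y → x + P i a * 1# + P j a * 1# + y) (symmetric G a i) (I-sym a i) ⟩
      adj G i a + P i a * 1# + P j a * 1# + I i a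
        ≡⟨ solve 3 (λ x y z → x :+ (x :+ y) :* con 1# :+ z :* con 1# :+ y := z) refl
             (adj G i a) (I i a) (P j a) ⟩
      P j a ∎
    column-j : adj M a j + I a j ≡ P i a
    column-j = begin
      adj M a j + I a j
        ≡⟨ cong (_+ I a j) (edgeLC-adj a j) ⟩
      adj G a j + P i a * P j j + P j a * P i j + I a j
        ≡⟨ cong₂ (λ x y → adj G a j + P i a * x + P j a * y + I a j) (P-diag j) Pij ⟩
      adj G a j + P i a * 1# + P j a * 1# + I a j
        ≡⟨ cong₂ (λ x y → x + P i a * 1# + P j a * 1# + y) (symmetric G a j) (I-sym a j) ⟩
      adj G j a + P i a * 1# + P j a * 1# + I j a
        ≡⟨ solve 3 (λ x y z → x :+ z :* con 1# :+ (x :+ y) :* con 1# :+ y := z) refl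
             (adj G j a) (I j a) (P i a) ⟩
      P i a ∎

-- Edge-local equivalence and exchanges

open EdgeLC using (edge; edgeLC-exchanges; i≢j)

-- Each step contributes the vector of its edge; these add up along the sequence by
-- `exchanges-trans`.
equivalent⇒exchanges : {G G′ : Graph n} → EdgeLocallyEquivalent G G′ → ∃[ a ] Exchanges a G G′
equivalent⇒exchanges (done G≈G′)     = _ , exchanges-refl G≈G′
equivalent⇒exchanges {G = G} (step i j ij r) with equivalent⇒exchanges r
... | _ , e = _ , exchanges-trans (edgeLC-exchanges G i j ij) e

-- If i had no neighbour in the support of a, column i of the system would read Γ′ + I = Γ + Γ′.
support-neighbour : {a : Vector 𝔽₂ n} {G G′ : Graph n} → Exchanges a G G′ →
                    ∀ i → a i ≡ 1# → ∃[ j ] (a j ≡ 1# × Edge G i j)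
support-neighbour {a = a} {G} {G′} e i ai
  with any? (λ j → (a j ≟ᵇ 1#) ×-dec (adj G i j ≟ᵇ 1#))
... | yes found = found
... | no  none  = contradiction (begin
  -- At the entry (i, i) both adjacency matrices vanish, so the equation there would read 1 = 0.
  1#                                            ≡⟨ cong₂ _+_ (loopless G′ i) (I-diag i) ⟨
  adj G′ i i + I i i                            ≡⟨ sum-I i (λ k → adj G′ i k + I i k) ⟨
  sum (λ k → I i k * (adj G′ i k + I i k))      ≡⟨ sum-cong-≗ term ⟨
  sum (λ k → coefficient G G′ i i k * a k)      ≡⟨ solves e i i ⟩
  adj G i i + adj G′ i i                        ≡⟨ cong₂ _+_ (loopless G i) (loopless G′ i) ⟩
  0#                                            ∎) λ ()
  where
  open ≡-Reasoning
  isolated : ∀ k → adj G k i * a k ≡ 0#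
  isolated k with a k in ak | adj G k i in ki
  ... | false | false = refl
  ... | false | true  = refl
  ... | true  | false = refl
  ... | true  | true  = contradiction (k , ak , trans (symmetric G i k) ki) none

  term : ∀ k → coefficient G G′ i i k * a k ≡ I i k * (adj G′ i k + I i k)
  term k = begin
    (adj G′ i k + I i k) * (adj G k i + I k i) * a k
      ≡⟨ solve 4 (λ p x y z → p :* (x :+ y) :* z := p :* (x :* z :+ y :* z)) refl
           (adj G′ i k + I i k) (adj G k i) (I k i) (a k) ⟩
    (adj G′ i k + I i k) * (adj G k i * a k + I k i * a k)
      ≡⟨ cong₂ (λ x y → (adj G′ i k + I i k) * (x + y)) (isolated k)
           (trans (cong (_* a k) (I-sym k i))
                  (trans (I-*-transport i k a) (trans (cong (I i k *_) ai) (∧-identityʳ _)))) ⟩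
    (adj G′ i k + I i k) * I i k
      ≡⟨ ∧-comm (adj G′ i k + I i k) (I i k) ⟩
    I i k * (adj G′ i k + I i k) ∎

-- Induction on a list containing the support of `a`. If its head x is in the support, complementing
-- along x and a neighbour j in the support clears both entries, so the new support lies in the
-- tail.
exchanges⇒equivalent : {a : Vector 𝔽₂ n} {G G′ : Graph n} → Exchanges a G G′ → EdgeLocallyEquivalent G G′
exchanges⇒equivalent {n} e = go (allFin n) e λ k _ → ∈-allFin k
  where
  go : ∀ xs {a : Vector 𝔽₂ n} {G G′ : Graph n} → Exchanges a G G′ →
       (∀ k → a k ≡ 1# → k ∈ xs) → EdgeLocallyEquivalent G G′
  go [] {a} e supported = done (exchanges-zero (λ k → ¬-not λ ak → contradiction (supported k ak) λ ()) e)
  go (x ∷ xs) {a} {G} e supported with a x in ax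
  ... | false = go xs e λ k ak → tail-∈ ak (supported k ak)
    where
    tail-∈ : ∀ {k} → a k ≡ 1# → k ∈ x ∷ xs → k ∈ xs
    tail-∈ ak (here refl) = contradiction (trans (sym ax) ak) λ ()
    tail-∈ ak (there k∈)  = k∈
  ... | true with support-neighbour e x ax
  ... | j , aj , xj =
    -- The vector of the edge leads back from the new graph to `G`, and `a` leads on to `G′`; their
    -- sum is the new vector.
    step x j xj (go xs (exchanges-trans (exchanges-sym (edgeLC-exchanges G x j xj)) e) λ k → shrink k)
    where
    shrink : ∀ k → edge G x j xj k + a k ≡ 1# → k ∈ xs
    shrink k eq with x ≟ k
    ... | yes refl = contradiction (trans (sym eq) (cong₂ _+_ (cong (1# +_) (I-off (i≢j G x j xj ∘ sym))) ax)) λ ()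
    ... | no x≢k with j ≟ k
    ...   | yes refl = contradiction (trans (sym eq) (cong (1# +_) aj)) λ ()
    ...   | no _ with supported k eq
    ...     | here k≡x = contradiction (sym k≡x) x≢k
    ...     | there k∈ = k∈

-- Running time

depth : Cmd k → ℕ
depth skip         = 0
depth (_ ≔ _)      = 0
depth (p ⨾ q)      = depth p ⊔ depth q
depth (cond _ p q) = depth p ⊔ depth q
depth (for p)      = suc (depth p)

-- For a program with a loop the bound below is 0 at n = 0, yet entering the loop costs one unit;
-- hence n is positive.
module RunningTime (n : ℕ) .{{_ : NonZero n}} where
  open Semantics n

  -- A loop adds 2: one for entering it and one for the tick of each iteration. A conditional takes
  -- the sum of its branches as a bound for either.
  weight : Cmd k → ℕ
  weight skip         = 1
  weight (c ≔ e)      = accessCost c ℕ.+ evalCost e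
  weight (p ⨾ q)      = weight p ℕ.+ weight q
  weight (cond e p q) = suc (evalCost e) ℕ.+ (weight p ℕ.+ weight q)
  weight (for p)      = 2 ℕ.+ weight p

  open ℕₚ.≤-Reasoning

  weaken : ∀ w {d d′} → d ≤ d′ → w ℕ.* n ^ d ≤ w ℕ.* n ^ d′
  weaken w d≤d′ = ℕₚ.*-monoʳ-≤ w (ℕₚ.^-monoʳ-≤ n d≤d′)

  foldl-time : ∀ {A : Set} (f : State → A → State) B → (∀ i s → proj₂ (f s i) ≤ proj₂ s ℕ.+ B) →
               ∀ xs s → proj₂ (foldl f s xs) ≤ proj₂ s ℕ.+ length xs ℕ.* B
  foldl-time f B bound []       s = ℕₚ.m≤m+n (proj₂ s) 0
  foldl-time f B bound (x ∷ xs) s = begin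
    proj₂ (foldl f (f s x) xs)               ≤⟨ foldl-time f B bound xs (f s x) ⟩
    proj₂ (f s x) ℕ.+ length xs ℕ.* B        ≤⟨ ℕₚ.+-monoˡ-≤ _ (bound x s) ⟩
    proj₂ s ℕ.+ B ℕ.+ length xs ℕ.* B        ≡⟨ ℕₚ.+-assoc (proj₂ s) B _ ⟩
    proj₂ s ℕ.+ (B ℕ.+ length xs ℕ.* B)      ∎

  -- Since 1 ≤ n and 1 ≤ N, the entry tick and the n iteration ticks together are at most twice
  -- `n * N`.
  loop-cost : ∀ w N → 1 ≤ N → 1 ℕ.+ n ℕ.* (1 ℕ.+ w ℕ.* N) ≤ (2 ℕ.+ w) ℕ.* (n ℕ.* N)
  loop-cost w N 1≤N = begin
    1 ℕ.+ n ℕ.* (1 ℕ.+ w ℕ.* N)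
      ≡⟨ cong (1 ℕ.+_) (ℕₚ.*-distribˡ-+ n 1 (w ℕ.* N)) ⟩
    1 ℕ.+ (n ℕ.* 1 ℕ.+ n ℕ.* (w ℕ.* N))
      ≤⟨ ℕₚ.+-mono-≤ (ℕₚ.*-mono-≤ (ℕ.>-nonZero⁻¹ n) 1≤N)
           (ℕₚ.+-mono-≤ (ℕₚ.*-monoʳ-≤ n 1≤N) (ℕₚ.≤-reflexive swap)) ⟩
    n ℕ.* N ℕ.+ (n ℕ.* N ℕ.+ w ℕ.* (n ℕ.* N)) ∎
    where
    swap : n ℕ.* (w ℕ.* N) ≡ w ℕ.* (n ℕ.* N)
    swap = trans (sym (ℕₚ.*-assoc n w N))
             (trans (cong (ℕ._* N) (ℕₚ.*-comm n w)) (ℕₚ.*-assoc w n N))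

  branch-cost : ∀ t c {w w′ d d′} → w ≤ w′ → d ≤ d′ →
           t ℕ.+ suc c ℕ.+ w ℕ.* n ^ d ≤ t ℕ.+ (suc c ℕ.+ w′) ℕ.* n ^ d′
  branch-cost t c {w} {w′} {d} {d′} w≤w′ d≤d′ = begin
    t ℕ.+ suc c ℕ.+ w ℕ.* n ^ d
      ≡⟨ ℕₚ.+-assoc t (suc c) _ ⟩
    t ℕ.+ (suc c ℕ.+ w ℕ.* n ^ d)
      ≤⟨ ℕₚ.+-monoʳ-≤ t (ℕₚ.+-mono-≤ (ℕₚ.m≤m*n (suc c) (n ^ d′) {{ℕₚ.m^n≢0 n d′}})
           (ℕₚ.*-mono-≤ w≤w′ (ℕₚ.^-monoʳ-≤ n d≤d′))) ⟩
    t ℕ.+ (suc c ℕ.* n ^ d′ ℕ.+ w′ ℕ.* n ^ d′)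
      ≡⟨ cong (t ℕ.+_) (ℕₚ.*-distribʳ-+ (n ^ d′) (suc c) w′) ⟨
    t ℕ.+ (suc c ℕ.+ w′) ℕ.* n ^ d′ ∎

  exec-time : ∀ (c : Cmd k) ρ s → proj₂ (exec c ρ s) ≤ proj₂ s ℕ.+ weight c ℕ.* n ^ depth c
  exec-time skip    ρ s = ℕₚ.≤-refl
  exec-time (c ≔ e) ρ s = ℕₚ.≤-reflexive (cong (proj₂ s ℕ.+_) (sym (ℕₚ.*-identityʳ _)))
  exec-time (p ⨾ q) ρ s = begin
    proj₂ (exec q ρ (exec p ρ s))
      ≤⟨ exec-time q ρ (exec p ρ s) ⟩
    proj₂ (exec p ρ s) ℕ.+ weight q ℕ.* n ^ depth q
      ≤⟨ ℕₚ.+-mono-≤ (exec-time p ρ s) (weaken (weight q) (ℕₚ.m≤n⊔m (depth p) (depth q))) ⟩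
    proj₂ s ℕ.+ weight p ℕ.* n ^ depth p ℕ.+ weight q ℕ.* N
      ≤⟨ ℕₚ.+-monoˡ-≤ _ (ℕₚ.+-monoʳ-≤ (proj₂ s) (weaken (weight p) (ℕₚ.m≤m⊔n (depth p) (depth q)))) ⟩
    proj₂ s ℕ.+ weight p ℕ.* N ℕ.+ weight q ℕ.* N
      ≡⟨ ℕₚ.+-assoc (proj₂ s) _ _ ⟩
    proj₂ s ℕ.+ (weight p ℕ.* N ℕ.+ weight q ℕ.* N)
      ≡⟨ cong (proj₂ s ℕ.+_) (ℕₚ.*-distribʳ-+ N (weight p) (weight q)) ⟨
    proj₂ s ℕ.+ (weight p ℕ.+ weight q) ℕ.* N ∎
    where N = n ^ (depth p ⊔ depth q)
  exec-time (cond e p q) ρ (m , t) with eval ρ m e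
  ... | true  = begin
    proj₂ (exec p ρ (m , t ℕ.+ suc (evalCost e)))
      ≤⟨ exec-time p ρ _ ⟩
    t ℕ.+ suc (evalCost e) ℕ.+ weight p ℕ.* n ^ depth p
      ≤⟨ branch-cost t (evalCost e) (ℕₚ.m≤m+n (weight p) (weight q)) (ℕₚ.m≤m⊔n (depth p) (depth q)) ⟩
    t ℕ.+ weight (cond e p q) ℕ.* n ^ (depth p ⊔ depth q) ∎
  ... | false = begin
    proj₂ (exec q ρ (m , t ℕ.+ suc (evalCost e)))
      ≤⟨ exec-time q ρ _ ⟩
    t ℕ.+ suc (evalCost e) ℕ.+ weight q ℕ.* n ^ depth q
      ≤⟨ branch-cost t (evalCost e) (ℕₚ.m≤n+m (weight q) (weight p)) (ℕₚ.m≤n⊔m (depth p) (depth q)) ⟩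
    t ℕ.+ weight (cond e p q) ℕ.* n ^ (depth p ⊔ depth q) ∎
  exec-time (for p) ρ (m , t) = begin
    proj₂ (exec (for p) ρ (m , t))
      ≤⟨ foldl-time _ (1 ℕ.+ weight p ℕ.* n ^ depth p) body (allFin n) (m , t ℕ.+ 1) ⟩
    t ℕ.+ 1 ℕ.+ length (allFin n) ℕ.* (1 ℕ.+ weight p ℕ.* n ^ depth p)
      ≡⟨ cong (λ l → t ℕ.+ 1 ℕ.+ l ℕ.* (1 ℕ.+ weight p ℕ.* n ^ depth p)) (length-tabulate {n = n} id) ⟩
    t ℕ.+ 1 ℕ.+ n ℕ.* (1 ℕ.+ weight p ℕ.* n ^ depth p)
      ≡⟨ ℕₚ.+-assoc t 1 _ ⟩
    t ℕ.+ (1 ℕ.+ n ℕ.* (1 ℕ.+ weight p ℕ.* n ^ depth p))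
      ≤⟨ ℕₚ.+-monoʳ-≤ t (loop-cost (weight p) (n ^ depth p) (ℕₚ.m^n>0 n (depth p))) ⟩
    t ℕ.+ weight (for p) ℕ.* n ^ depth (for p) ∎
    where
    body : ∀ i s → proj₂ (exec p (i Vector.∷ ρ) (tick 1 s)) ≤ proj₂ s ℕ.+ (1 ℕ.+ weight p ℕ.* n ^ depth p)
    body i s = begin
      proj₂ (exec p (i Vector.∷ ρ) (tick 1 s))            ≤⟨ exec-time p _ (tick 1 s) ⟩
      proj₂ s ℕ.+ 1 ℕ.+ weight p ℕ.* n ^ depth p         ≡⟨ ℕₚ.+-assoc (proj₂ s) 1 _ ⟩
      proj₂ s ℕ.+ (1 ℕ.+ weight p ℕ.* n ^ depth p)       ∎

-- The decision program

-- The numbers 0, 1 and 2 are prescribed by the convention for input and output; δ holds I.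
Γ Γ′ out δ basis point value pivot residue : ℕ
Γ       = 0
Γ′      = 1
out     = 2
δ       = 3
basis   = 4
point   = 5
value   = 6
pivot   = 7
residue = 8

coefficientE : (i j l : Fin k) → Expr k
coefficientE i j l = mul (add (read (Γ′ , i ∷ l ∷ [])) (read (δ , i ∷ l ∷ [])))
                         (add (read (Γ  , l ∷ j ∷ [])) (read (δ , l ∷ j ∷ [])))

-- All cells outside the input arrays start at 0, so writing the diagonals makes `δ` and `basis` the
-- identity, and `point` starts as the zero vector.
initializeRow : Cmd (1 ℕ.+ k)
initializeRow = ((δ , 0F ∷ 0F ∷ []) ≔ lit 1#) ⨾ ((basis , 0F ∷ 0F ∷ []) ≔ lit 1#)

initialize : Cmd k
initialize = for initializeRow

-- Here 3F and 2F name the equation (i, j), 1F the basis vector and 0F the summation index.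
basisValue : Expr (4 ℕ.+ k)
basisValue = mul (coefficientE 3F 2F 0F) (read (basis , 1F ∷ 0F ∷ []))

evaluateRow : Cmd (3 ℕ.+ k)
evaluateRow = ((value , 0F ∷ []) ≔ lit 0#)
            ⨾ for ((value , 1F ∷ []) ≔ add (read (value , 1F ∷ [])) basisValue)

evaluate : Cmd (2 ℕ.+ k)
evaluate = for evaluateRow

-- A branch written as arithmetic: the entry of the current basis vector if its value is 1, else the
-- old pivot. The last violating vector becomes the pivot.
candidate : Expr (2 ℕ.+ k)
candidate = add (read (pivot , 0F ∷ []))
  (mul (read (value , 1F ∷ [])) (add (read (pivot , 0F ∷ [])) (read (basis , 1F ∷ 0F ∷ []))))

considerRow : Cmd (1 ℕ.+ k)
considerRow = for ((pivot , 0F ∷ []) ≔ candidate)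

choosePivot : Cmd k
choosePivot = for considerRow

pointValue : Expr (3 ℕ.+ k)
pointValue = mul (coefficientE 2F 1F 0F) (read (point , 0F ∷ []))

-- The residue starts as the right side of the equation and collects the left side at `point`; it
-- ends at 0 exactly if `point` satisfies the equation.
startResidue : Cmd (2 ℕ.+ k)
startResidue = (residue , []) ≔ add (read (Γ , 1F ∷ 0F ∷ [])) (read (Γ′ , 1F ∷ 0F ∷ []))

computeResidue : Cmd (2 ℕ.+ k)
computeResidue = startResidue ⨾ for ((residue , []) ≔ add (read (residue , [])) pointValue)

movedPoint : Expr (1 ℕ.+ k)
movedPoint = add (read (point , 0F ∷ [])) (mul (read (residue , [])) (read (pivot , 0F ∷ [])))

movePoint : Cmd k
movePoint = for ((point , 0F ∷ []) ≔ movedPoint)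

-- `pivot` is a copy, so it survives the clearing of the basis vector it came from; `value` still
-- holds the values from before the move.
movedBasis : Expr (2 ℕ.+ k)
movedBasis = add (read (basis , 1F ∷ 0F ∷ [])) (mul (read (value , 1F ∷ [])) (read (pivot , 0F ∷ [])))

moveRow : Cmd (1 ℕ.+ k)
moveRow = for ((basis , 1F ∷ 0F ∷ []) ≔ movedBasis)

moveBasis : Cmd k
moveBasis = for moveRow

-- The two outer loop variables i, j (subscripts 1F, 0F here) name the equation.
eliminate : Cmd (2 ℕ.+ k)
eliminate = evaluate ⨾ choosePivot ⨾ computeResidue ⨾ movePoint ⨾ moveBasis

-- `out` accumulates the conjunction of the tests: the factor is 1 exactly when the equation holds.
verify : Cmd (2 ℕ.+ k)
verify = computeResidue
       ⨾ ((out , []) ≔ mul (read (out , [])) (add (lit 1#) (read (residue , []))))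

decide : Program
decide = initialize ⨾ for (for eliminate) ⨾ ((out , []) ≔ lit 1#) ⨾ for (for verify)

-- Arrays touched by a program, and folds

-- Computable from the text, so that on concrete programs the side conditions of `frame` hold by
-- `refl`.
writes : ℕ → Cmd k → Bool
writes x skip           = false
writes x ((y , _) ≔ _)  = x ≡ᵇ y
writes x (p ⨾ q)        = writes x p ∨ writes x q
writes x (cond _ p q)   = writes x p ∨ writes x q
writes x (for p)        = writes x p

reads : ℕ → Expr k → Bool
reads x (lit _)        = false
reads x (read (y , _)) = x ≡ᵇ y
reads x (add e f)      = reads x e ∨ reads x f
reads x (mul e f)      = reads x e ∨ reads x f

∨-false : ∀ x {y} → x ∨ y ≡ false → x ≡ false × y ≡ false
∨-false false y≡false = refl , y≡false

≡ᵇ-false : ∀ {x y} → (x ≡ᵇ y) ≡ false → x ≢ y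
≡ᵇ-false {suc x} eq refl = ≡ᵇ-false {x} eq refl

foldl-tabulate : {A S : Set} (f : S → A → S) (P : ℕ → S → Set) (g : Fin n → A) {s : S} →
                 P 0 s → (∀ i s → P (toℕ i) s → P (suc (toℕ i)) (f s (g i))) →
                 P n (foldl f s (tabulate g))
foldl-tabulate {zero}  f P g base next = base
foldl-tabulate {suc n} f P g base next =
  foldl-tabulate f (P ∘ suc) (g ∘ suc) (next 0F _ base) λ i → next (suc i)

foldl-simulation : {A S T : Set} (R : S → T → Set) (f : S → A → S) (g : T → A → T) →
                   (∀ x {s t} → R s t → R (f s x) (g t x)) →
                   ∀ xs {s t} → R s t → R (foldl f s xs) (foldl g t xs)
foldl-simulation R f g simulate []       r = r
foldl-simulation R f g simulate (x ∷ xs) r = foldl-simulation R f g simulate xs (simulate x r)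

foldl-sum : {A : Set} (γ : A → 𝔽₂) (g : Fin n → A) (b : 𝔽₂) →
            foldl (λ b x → b + γ x) b (tabulate g) ≡ b + sum (γ ∘ g)
foldl-sum {zero}  γ g b = sym (xor-identityʳ b)
foldl-sum {suc n} γ g b = trans (foldl-sum γ (g ∘ suc) (b + γ (g 0F)))
                                (xor-assoc b (γ (g 0F)) (sum (γ ∘ g ∘ suc)))

-- The flag `i <ᵇ t` marks the iterations among the first t; passing from j to j + 1 changes it for
-- j alone.
suc-<ᵇ : ∀ {i j} → i ≢ j → (i <ᵇ suc j) ≡ (i <ᵇ j)
suc-<ᵇ {zero}  {zero}  i≢j = contradiction refl i≢j
suc-<ᵇ {zero}  {suc j} i≢j = refl
suc-<ᵇ {suc i} {zero}  i≢j = refl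
suc-<ᵇ {suc i} {suc j} i≢j = suc-<ᵇ {i} {j} (i≢j ∘ cong suc)

<⇒<ᵇ-true : ∀ {i j} → i ℕ.< j → (i <ᵇ j) ≡ true
<⇒<ᵇ-true {zero}  {suc j} i<j       = refl
<⇒<ᵇ-true {suc i} {suc j} (ℕ.s≤s p) = <⇒<ᵇ-true p

n<ᵇ1+n : ∀ i → (i <ᵇ suc i) ≡ true
n<ᵇ1+n i = <⇒<ᵇ-true (ℕₚ.n<1+n i)

-- Loop rules

module Memories (n : ℕ) where
  open Semantics n

  write-here : ∀ {p q} v m → p ≡ q → write p v m q ≡ v
  write-here {p} {q} v m p≡q with ×-≡-dec ℕₚ._≟_ (≡-dec _≟_) p q
  ... | yes _  = refl
  ... | no p≢q = contradiction p≡q p≢q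

  write-elsewhere : ∀ {p q} v m → p ≢ q → write p v m q ≡ m q
  write-elsewhere {p} {q} v m p≢q with ×-≡-dec ℕₚ._≟_ (≡-dec _≟_) p q
  ... | yes p≡q = contradiction p≡q p≢q
  ... | no _    = refl

  for-invariant : (p : Cmd (suc k)) {ρ : Env k} (P : ℕ → Memory → Set) {s : State} →
                  P 0 (proj₁ s) →
                  (∀ i s → P (toℕ i) (proj₁ s) →
                           P (suc (toℕ i)) (proj₁ (exec p (i Vector.∷ ρ) s))) →
                  P n (proj₁ (exec (for p) ρ s))
  for-invariant p P base next =
    foldl-tabulate _ (λ i s → P i (proj₁ s)) id base λ i s → next i (tick 1 s)

  for-preserves : (p : Cmd (suc k)) {ρ : Env k} (P : Memory → Set) {s : State} →
                  P (proj₁ s) →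
                  (∀ i s → P (proj₁ s) → P (proj₁ (exec p (i Vector.∷ ρ) s))) →
                  P (proj₁ (exec (for p) ρ s))
  for-preserves p P = for-invariant p (λ _ → P)

  -- Addresses carry the array name, so a write to another array cannot hit the cell, whatever the
  -- subscripts.
  frame : ∀ x (c : Cmd k) {ρ : Env k} {s : State} → writes x c ≡ false →
          ∀ is → proj₁ (exec c ρ s) (x , is) ≡ proj₁ s (x , is)
  frame x skip eq is = refl
  frame x ((y , js) ≔ e) {ρ} {s} eq is =
    write-elsewhere {p = y , map ρ js} _ (proj₁ s) λ p≡q → ≡ᵇ-false {x} eq (sym (,-injectiveˡ p≡q))
  frame x (p ⨾ q) eq is with ∨-false (writes x p) eq
  ... | p-eq , q-eq = trans (frame x q q-eq is) (frame x p p-eq is)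
  frame x (cond e p q) {ρ} {m , t} eq is with ∨-false (writes x p) eq | eval ρ m e
  ... | p-eq , q-eq | true  = frame x p p-eq is
  ... | p-eq , q-eq | false = frame x q q-eq is
  frame x (for p) {s = s} eq is =
    for-preserves p (λ m → m (x , is) ≡ proj₁ s (x , is)) refl λ i s same →
      trans (frame x p eq is) same

  eval-frame : ∀ x (e : Expr k) {ρ : Env k} {m m′ : Memory} → reads x e ≡ false →
               (∀ y is → x ≢ y → m′ (y , is) ≡ m (y , is)) → eval ρ m′ e ≡ eval ρ m e
  eval-frame x (lit v)         eq same = refl
  eval-frame x (read (y , is)) eq same = same y _ (≡ᵇ-false {x} eq)
  eval-frame x (add e f)       eq same with ∨-false (reads x e) eq
  ... | e-eq , f-eq = cong₂ _+_ (eval-frame x e e-eq same) (eval-frame x f f-eq same)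
  eval-frame x (mul e f)       eq same with ∨-false (reads x e) eq
  ... | e-eq , f-eq = cong₂ _*_ (eval-frame x e e-eq same) (eval-frame x f f-eq same)

  -- The Boolean index of Q tells whether the iteration i has already been executed.
  for-each : (p : Cmd (suc k)) {ρ : Env k} {s : State}
             (R : Memory → Set) (Q : Bool → Fin n → Memory → Set) →
             R (proj₁ s) → (∀ i → Q false i (proj₁ s)) →
             (∀ i s → let s′ = exec p (i Vector.∷ ρ) s in
               R (proj₁ s) → Q false i (proj₁ s) →
               R (proj₁ s′) × Q true i (proj₁ s′)
                 × (∀ b j → j ≢ i → Q b j (proj₁ s) → Q b j (proj₁ s′))) →
             R (proj₁ (exec (for p) ρ s)) × (∀ i → Q true i (proj₁ (exec (for p) ρ s)))
  for-each p {ρ} {s} R Q r q body =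
    proj₁ final , λ i → at (proj₁ (exec (for p) ρ s)) (<⇒<ᵇ-true (toℕ<n i)) (proj₂ final i)
    where
    at : ∀ m {i b b′} → b ≡ b′ → Q b i m → Q b′ i m
    at m refl q = q

    irrefl : ∀ i → (i <ᵇ i) ≡ false
    irrefl zero    = refl
    irrefl (suc i) = irrefl i

    P : ℕ → Memory → Set
    P l m = R m × (∀ j → Q (toℕ j <ᵇ l) j m)

    next : ∀ i s → P (toℕ i) (proj₁ s) → P (suc (toℕ i)) (proj₁ (exec p (i Vector.∷ ρ) s))
    next i s (r , q) = proj₁ iteration , λ j → advance j (j ≟ i)
      where
      iteration = body i s r (at (proj₁ s) (irrefl (toℕ i)) (q i))
      m′   = proj₁ (exec p (i Vector.∷ ρ) s)
      advance : ∀ j → Dec (j ≡ i) → Q (toℕ j <ᵇ suc (toℕ i)) j m′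
      advance j (yes refl) = at m′ (sym (n<ᵇ1+n (toℕ i))) (proj₁ (proj₂ iteration))
      advance j (no j≢i)   = at m′ (sym (suc-<ᵇ (j≢i ∘ toℕ-injective)))
        (proj₂ (proj₂ iteration) (toℕ j <ᵇ toℕ i) j j≢i (q j))

    final : P n (proj₁ (exec (for p) ρ s))
    final = for-invariant p P (r , q) next

  -- `for-each` with a trivial claim before an iteration has run; what has been established must
  -- survive every iteration.
  for-establishes : (p : Cmd (suc k)) {ρ : Env k} {s : State}
                    (R : Memory → Set) (Q : Fin n → Memory → Set) →
                    R (proj₁ s) →
                    (∀ i s → let s′ = exec p (i Vector.∷ ρ) s in
                      R (proj₁ s) → R (proj₁ s′) × Q i (proj₁ s′)
                        × (∀ j → Q j (proj₁ s) → Q j (proj₁ s′))) →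
                    R (proj₁ (exec (for p) ρ s)) × (∀ i → Q i (proj₁ (exec (for p) ρ s)))
  for-establishes p {ρ} R Q r body = for-each p R Q? r (λ _ → tt) next
    where
    Q? : Bool → Fin n → Memory → Set
    Q? b i m = if b then Q i m else ⊤
    next : ∀ i s → let s′ = exec p (i Vector.∷ ρ) s in
           R (proj₁ s) → ⊤ → R (proj₁ s′) × Q i (proj₁ s′)
             × (∀ b j → j ≢ i → Q? b j (proj₁ s) → Q? b j (proj₁ s′))
    next i s r _ = proj₁ iteration , proj₁ (proj₂ iteration) , others
      where
      iteration = body i s r
      others : ∀ b j → j ≢ i → Q? b j (proj₁ s) → Q? b j (proj₁ (exec p (i Vector.∷ ρ) s))
      others false j _ _ = tt
      others true  j _ q = proj₂ (proj₂ iteration) j q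

  -- All iterations hit one cell and `e` does not read its array, so each summand has its value from
  -- before the loop. The loop is simulated by a fold over values alone.
  for-sum : ∀ {x} is (e : Expr (suc k)) {ρ : Env k} {js} →
            (∀ l → map (l Vector.∷ ρ) is ≡ js) → reads x e ≡ false → ∀ s →
            let m  = proj₁ s
                m′ = proj₁ (exec (for ((x , is) ≔ add (read (x , is)) e)) ρ s)
            in m′ (x , js) ≡ m (x , js) + sum (λ l → eval (l Vector.∷ ρ) m e)
               × (∀ q → q ≢ (x , js) → m′ q ≡ m q)
  for-sum {x = x} is e {ρ} {js} constant eq s
    with foldl-simulation
      (λ s′ b → proj₁ s′ (x , js) ≡ b × (∀ q → q ≢ (x , js) → proj₁ s′ q ≡ proj₁ s q))
      (λ s′ l → exec ((x , is) ≔ add (read (x , is)) e) (l Vector.∷ ρ) (tick 1 s′))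
      (λ b l → b + eval (l Vector.∷ ρ) (proj₁ s) e)
      (λ l {s′} (updated , elsewhere) →
        trans (write-here _ (proj₁ s′) (cong (x ,_) (constant l)))
          (cong₂ _+_ (trans (cong (λ is → proj₁ s′ (x , is)) (constant l)) updated)
            (eval-frame x e eq λ y is x≢y → elsewhere (y , is) λ q≡ → x≢y (sym (,-injectiveˡ q≡)))) ,
        λ q q≢ → trans (write-elsewhere _ (proj₁ s′) λ p≡q →
                   q≢ (trans (sym p≡q) (cong (x ,_) (constant l)))) (elsewhere q q≢))
      (allFin n) {tick 1 s} (refl , λ q _ → refl)
  ... | updated , elsewhere = trans updated (foldl-sum (λ l → eval (l Vector.∷ ρ) (proj₁ s) e) id (proj₁ s (x , js))) , elsewhere

  -- The iterations write distinct cells, and `e` depends at most on the cell about to be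
  -- overwritten and on cells the loop never writes. The loop therefore acts as a simultaneous
  -- assignment.
  for-assign : (c : Cell (suc k)) (e : Expr (suc k)) {ρ : Env k} →
               (∀ {l l′} → address (l Vector.∷ ρ) c ≡ address (l′ Vector.∷ ρ) c → l ≡ l′) →
               ∀ s → let m  = proj₁ s
                         m′ = proj₁ (exec (for (c ≔ e)) ρ s)
               in (∀ l m″ → m″ (address (l Vector.∷ ρ) c) ≡ m (address (l Vector.∷ ρ) c) →
                     (∀ q → (∀ l → address (l Vector.∷ ρ) c ≢ q) → m″ q ≡ m q) →
                     eval (l Vector.∷ ρ) m″ e ≡ eval (l Vector.∷ ρ) m e) →
                  (∀ q → (∀ l → address (l Vector.∷ ρ) c ≢ q) → m′ q ≡ m q)
                  × (∀ l → m′ (address (l Vector.∷ ρ) c) ≡ eval (l Vector.∷ ρ) m e)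
  for-assign c e {ρ} injective s independent =
    for-each (c ≔ e) {ρ} {s}
      (λ m → ∀ q → (∀ l → address (l Vector.∷ ρ) c ≢ q) → m q ≡ proj₁ s q)
      (λ b l m → m (address (l Vector.∷ ρ) c) ≡
                 (if b then eval (l Vector.∷ ρ) (proj₁ s) e else proj₁ s (address (l Vector.∷ ρ) c)))
      (λ q _ → refl) (λ _ → refl)
      λ l s′ elsewhere own →
        (λ q q≢ → trans (write-elsewhere _ (proj₁ s′) (q≢ l)) (elsewhere q q≢)) ,
        trans (write-here _ (proj₁ s′) refl) (independent l (proj₁ s′) own elsewhere) ,
        λ b j j≢l same → trans (write-elsewhere _ (proj₁ s′) (λ eq → j≢l (sym (injective eq)))) same

-- Affine elimination

dot : Vector 𝔽₂ n → Vector 𝔽₂ n → 𝔽₂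
dot f v = sum (λ l → f l * v l)

dot-+-* : (f v w : Vector 𝔽₂ n) (t : 𝔽₂) → dot f (λ l → v l + t * w l) ≡ dot f v + t * dot f w
dot-+-* f v w t = trans
  (sum-+-cong λ l → solve 4 (λ f v w t → f :* (v :+ t :* w) := f :* v :+ t :* (f :* w)) refl
                      (f l) (v l) (w l) t)
  (cong (dot f v +_) (sym (*-distribˡ-sum t (λ l → f l * w l))))

dot-cong : (f : Vector 𝔽₂ n) {v w : Vector 𝔽₂ n} → (∀ l → v l ≡ w l) → dot f v ≡ dot f w
dot-cong f v≗w = sum-cong-≗ λ l → cong (f l *_) (v≗w l)

Kills : Vector 𝔽₂ n → Matrix n → Set
Kills f V = ∀ k → dot f (V k) ≡ 0#

-- The solution a is the image of itself under the affine projection x ↦ p + Σ x_k V_k.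
record Fixes (a p : Vector 𝔽₂ n) (V : Matrix n) : Set where
  field fixed : ∀ l → a l ≡ p l + sum (λ k → a k * V k l)

open Fixes

-- In the first case w is arbitrary: every multiplier dot f (V k) vanishes.
IsPivot : Vector 𝔽₂ n → Matrix n → Vector 𝔽₂ n → Set
IsPivot f V w = Kills f V ⊎ (∃[ k ] (dot f (V k) ≡ 1# × (∀ l → w l ≡ V k l)))

module _ {f w : Vector 𝔽₂ n} {V V′ : Matrix n}
         (V′-def : ∀ k l → V′ k l ≡ V k l + dot f (V k) * w l) where

  dot-V′ : ∀ g k → dot g (V′ k) ≡ dot g (V k) + dot f (V k) * dot g w
  dot-V′ g k = trans (dot-cong g (V′-def k)) (dot-+-* g (V k) w (dot f (V k)))

  -- Either all multipliers vanish and nothing moves, or `w` is itself one of the vectors that `g`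
  -- kills.
  kills-preserved : IsPivot f V w → ∀ g → Kills g V → Kills g V′
  kills-preserved (inj₁ f-kills) g kills k = trans (dot-V′ g k)
    (cong₂ (λ x y → x + y * dot g w) (kills k) (f-kills k))
  kills-preserved (inj₂ (k₀ , _ , w≗V)) g kills k = trans (dot-V′ g k)
    (trans (cong₂ (λ x y → x + dot f (V k) * y) (kills k) (trans (dot-cong g w≗V) (kills k₀)))
           (∧-zeroʳ (dot f (V k))))

  -- If there is a pivot, `f` is 1 on `w`, so adding `dot f (V k)` times `w` cancels the value on
  -- `V k`. The pivot vector itself becomes zero.
  kills-new : IsPivot f V w → Kills f V′
  kills-new (inj₁ f-kills) k = trans (dot-V′ f k)
    (cong (λ x → x + x * dot f w) (f-kills k))
  kills-new (inj₂ (k₀ , one , w≗V)) k = trans (dot-V′ f k)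
    (trans (cong (λ x → dot f (V k) + dot f (V k) * x) (trans (dot-cong f w≗V) one))
           (solve 1 (λ x → x :+ x :* con 1# := con 0#) refl (dot f (V k))))

fixes-dot : {a p : Vector 𝔽₂ n} {V : Matrix n} → Fixes a p V → ∀ f →
            dot f a ≡ dot f p + sum (λ k → a k * dot f (V k))
fixes-dot {a = a} {p} {V} h f = begin
  dot f a
    ≡⟨ dot-cong f (fixed h) ⟩
  sum (λ l → f l * (p l + sum (λ k → a k * V k l)))
    ≡⟨ sum-+-cong (λ l → trans
         (solve 3 (λ x y z → x :* (y :+ z) := x :* y :+ x :* z) refl (f l) (p l) (sum (λ k → a k * V k l)))
         (cong (f l * p l +_) (*-distribˡ-sum (f l) (λ k → a k * V k l)))) ⟩
  dot f p + sum (λ l → sum (λ k → f l * (a k * V k l)))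
    ≡⟨ cong (dot f p +_) (∑-comm (λ l k → f l * (a k * V k l))) ⟩
  dot f p + sum (λ k → sum (λ l → f l * (a k * V k l)))
    ≡⟨ cong (dot f p +_) (sum-cong-≗ λ k → trans
         (sum-cong-≗ λ l → solve 3 (λ x y z → x :* (y :* z) := y :* (x :* z)) refl (f l) (a k) (V k l))
         (sym (*-distribˡ-sum (a k) (λ l → f l * V k l)))) ⟩
  dot f p + sum (λ k → a k * dot f (V k)) ∎
  where open ≡-Reasoning

-- Why the final point is a solution: once `f` kills all directions, it cannot distinguish `p` from
-- `a`.
fixes-killed : {a p : Vector 𝔽₂ n} {V : Matrix n} → Fixes a p V → ∀ f → Kills f V → dot f p ≡ dot f a
fixes-killed {a = a} {p} h f kills = sym (trans (fixes-dot h f)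
  (trans (cong (dot f p +_) (sum-zero λ k → trans (cong (a k *_) (kills k)) (∧-zeroʳ (a k))))
         (xor-identityʳ (dot f p))))

-- The affine map is initially the identity, so every vector is fixed.
fixes-init : {a p : Vector 𝔽₂ n} {V : Matrix n} → (∀ l → p l ≡ 0#) → V ≋ I → Fixes a p V
fixes-init {a = a} {p} {V} p≡0 V≋I .fixed l = sym (trans
  (cong₂ _+_ (p≡0 l) (sum-cong-≗ λ k → trans (cong (a k *_) (trans (V≋I k l) (I-sym k l))) (∧-comm (a k) (I l k))))
  (sum-I l a))

-- The multipliers of w collected on the right add up to dot f a + b = 0, whatever w is.
fixes-preserved : {a p p′ f w : Vector 𝔽₂ n} {V V′ : Matrix n} {b : 𝔽₂} → dot f a ≡ b →
                  (∀ k l → V′ k l ≡ V k l + dot f (V k) * w l) →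
                  (∀ l → p′ l ≡ p l + (b + dot f p) * w l) →
                  Fixes a p V → Fixes a p′ V′
fixes-preserved {a = a} {p} {p′} {f} {w} {V} {V′} {b} fa≡b V′-def p′-def h .fixed l = begin
  a l
    ≡⟨ fixed h l ⟩
  p l + Σ₁
    -- The two products with `w l` are each inserted twice, which adds zero in characteristic 2.
    ≡⟨ solve 4 (λ p s x t → p :+ s := p :+ (x :+ t :+ x :+ t) :+ s) refl (p l) Σ₁ (dot f p * w l) (Σ₂ * w l) ⟩
  p l + (dot f p * w l + Σ₂ * w l + dot f p * w l + Σ₂ * w l) + Σ₁
    ≡⟨ solve 5 (λ p s x t w → p :+ (x :* w :+ t :* w :+ x :* w :+ t :* w) :+ s
                            := p :+ ((x :+ t) :+ x) :* w :+ (s :+ t :* w)) refl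
         (p l) Σ₁ (dot f p) Σ₂ (w l) ⟩
  p l + (dot f p + Σ₂ + dot f p) * w l + (Σ₁ + Σ₂ * w l)
    ≡⟨ cong₂ (λ x y → p l + (x + dot f p) * w l + y) (trans (sym (fixes-dot h f)) fa≡b) (sym split) ⟩
  p l + (b + dot f p) * w l + sum (λ k → a k * V′ k l)
    ≡⟨ cong (_+ sum (λ k → a k * V′ k l)) (p′-def l) ⟨
  p′ l + sum (λ k → a k * V′ k l) ∎
  where
  open ≡-Reasoning
  Σ₁ = sum (λ k → a k * V k l)
  Σ₂ = sum (λ k → a k * dot f (V k))
  split : sum (λ k → a k * V′ k l) ≡ Σ₁ + Σ₂ * w l
  split = trans
    (sum-+-cong λ k → trans (cong (a k *_) (V′-def k l))
      (solve 4 (λ a v d w → a :* (v :+ d :* w) := a :* v :+ a :* d :* w) refl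
        (a k) (V k l) (dot f (V k)) (w l)))
    (cong (Σ₁ +_) (sym (*-distribʳ-sum (w l) (λ k → a k * dot f (V k)))))

-- Correctness of the program

module Correctness {n : ℕ} (G G′ : Graph n) where
  open Semantics n hiding (output; time)
  open Memories n

  basisOf : Memory → Matrix n
  basisOf m k l = m (basis , k ∷ l ∷ [])

  pointOf pivotOf valueOf : Memory → Vector 𝔽₂ n
  pointOf m l = m (point , l ∷ [])
  pivotOf m l = m (pivot , l ∷ [])
  valueOf m k = m (value , k ∷ [])

  residueOf outOf : Memory → 𝔽₂
  residueOf m = m (residue , [])
  outOf m     = m (out , [])

  record Ready (m : Memory) : Set where
    field
      Γ-ready  : ∀ i j → m (Γ  , i ∷ j ∷ []) ≡ adj G i j
      Γ′-ready : ∀ i j → m (Γ′ , i ∷ j ∷ []) ≡ adj G′ i j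
      δ-ready  : ∀ i j → m (δ  , i ∷ j ∷ []) ≡ I i j

  open Ready

  ready-preserved : (c : Cmd k) {ρ : Env k} {s : State} →
                    writes Γ c ∨ writes Γ′ c ∨ writes δ c ≡ false →
                    Ready (proj₁ s) → Ready (proj₁ (exec c ρ s))
  ready-preserved c eq r with ∨-false (writes Γ c) eq
  ... | eq₀ , eq′ with ∨-false (writes Γ′ c) eq′
  ... | eq₁ , eq₃ = record
    { Γ-ready  = λ i j → trans (frame Γ  c eq₀ (i ∷ j ∷ [])) (Γ-ready r i j)
    ; Γ′-ready = λ i j → trans (frame Γ′ c eq₁ (i ∷ j ∷ [])) (Γ′-ready r i j)
    ; δ-ready  = λ i j → trans (frame δ  c eq₃ (i ∷ j ∷ [])) (δ-ready r i j)
    }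

  residual : Vector 𝔽₂ n → Fin n → Fin n → 𝔽₂
  residual p i j = (adj G i j + adj G′ i j) + dot (coefficient G G′ i j) p

  coefficientE-eval : ∀ (i j l : Fin k) ρ m → Ready m →
                      eval ρ m (coefficientE i j l) ≡ coefficient G G′ (ρ i) (ρ j) (ρ l)
  coefficientE-eval i j l ρ m r =
    cong₂ _*_ (cong₂ _+_ (Γ′-ready r (ρ i) (ρ l)) (δ-ready r (ρ i) (ρ l)))
              (cong₂ _+_ (Γ-ready r (ρ l) (ρ j)) (δ-ready r (ρ l) (ρ j)))

  evaluate-spec : ∀ (ρ : Env (2 ℕ.+ k)) s → Ready (proj₁ s) → ∀ l →
                  valueOf (proj₁ (exec evaluate ρ s)) l
                    ≡ dot (coefficient G G′ (ρ 1F) (ρ 0F)) (basisOf (proj₁ s) l)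
  evaluate-spec ρ s ready = proj₂ (for-each evaluateRow {ρ} {s}
    (λ m → Ready m × (∀ k l → basisOf m k l ≡ basisOf (proj₁ s) k l))
    (λ b k m → if b then valueOf m k ≡ dot f (basisOf (proj₁ s) k) else ⊤)
    (ready , λ _ _ → refl) (λ _ → tt) row)
    where
    f = coefficient G G′ (ρ 1F) (ρ 0F)

    row : ∀ i s′ → let s″ = exec evaluateRow (i Vector.∷ ρ) s′ in
          Ready (proj₁ s′) × (∀ k l → basisOf (proj₁ s′) k l ≡ basisOf (proj₁ s) k l) → ⊤ →
          (Ready (proj₁ s″) × (∀ k l → basisOf (proj₁ s″) k l ≡ basisOf (proj₁ s) k l))
          × valueOf (proj₁ s″) i ≡ dot f (basisOf (proj₁ s) i)
          × (∀ b j → j ≢ i → (if b then valueOf (proj₁ s′) j ≡ dot f (basisOf (proj₁ s) j) else ⊤) →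
                             (if b then valueOf (proj₁ s″) j ≡ dot f (basisOf (proj₁ s) j) else ⊤))
    row i s′ (ready , same) _ =
      (ready-preserved evaluateRow {ρ′} {s′} refl ready ,
       λ k l → trans (frame basis evaluateRow {ρ′} {s′} refl (k ∷ l ∷ [])) (same k l)) ,
      trans (proj₁ total) (cong₂ _+_ (write-here {p = value , i ∷ []} 0# (proj₁ s′) refl)
        (sum-cong-≗ λ l → cong₂ _*_
           (coefficientE-eval 3F 2F 0F (l Vector.∷ ρ′) (proj₁ cleared)
              (ready-preserved clear {ρ′} {s′} refl ready))
           (trans (frame basis clear {ρ′} {s′} refl (i ∷ l ∷ [])) (same i l)))) ,
      others
      where
      ρ′ : Env _
      ρ′ = i Vector.∷ ρ
      clear : Cmd _
      clear = (value , 0F ∷ []) ≔ lit 0#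
      cleared : State
      cleared = exec clear ρ′ s′
      total = for-sum {x = value} (1F ∷ []) basisValue {ρ′} {i ∷ []} (λ _ → refl) refl cleared
      others : ∀ b j → j ≢ i → (if b then valueOf (proj₁ s′) j ≡ dot f (basisOf (proj₁ s) j) else ⊤) →
               (if b then valueOf (proj₁ (exec evaluateRow ρ′ s′)) j ≡ dot f (basisOf (proj₁ s) j) else ⊤)
      others false j _   _  = tt
      others true  j j≢i eq = trans (proj₂ total (value , j ∷ []) λ { refl → j≢i refl })
        (trans (write-elsewhere {p = value , i ∷ []} {value , j ∷ []} 0# (proj₁ s′) λ { refl → j≢i refl }) eq)

  choosePivot-spec : ∀ (ρ : Env k) s (f : Vector 𝔽₂ n) →
                     (∀ k → valueOf (proj₁ s) k ≡ dot f (basisOf (proj₁ s) k)) →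
                     IsPivot f (basisOf (proj₁ s)) (pivotOf (proj₁ (exec choosePivot ρ s)))
  choosePivot-spec ρ s f value-def = finish (for-invariant considerRow {ρ} P {s}
    ((λ _ _ → refl) , value-def , inj₁ λ _ ()) next)
    where
    V = basisOf (proj₁ s)
    -- After t rows, either none of them is violating or the pivot holds a violating one. In the
    -- first case it may keep entries from an earlier equation.
    Partial : ℕ → Vector 𝔽₂ n → Set
    Partial t w = (∀ k → toℕ k ℕ.< t → dot f (V k) ≡ 0#)
                  ⊎ (∃[ k ] (dot f (V k) ≡ 1# × (∀ l → w l ≡ V k l)))

    P : ℕ → Memory → Set
    P t m = (∀ k l → basisOf m k l ≡ V k l) × (∀ k → valueOf m k ≡ dot f (V k)) × Partial t (pivotOf m)

    update : ∀ i s′ l → let m = proj₁ s′ in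
             pivotOf (proj₁ (exec considerRow (i Vector.∷ ρ) s′)) l
               ≡ pivotOf m l + valueOf m i * (pivotOf m l + basisOf m i l)
    update i s′ = proj₂ (for-assign (pivot , 0F ∷ []) candidate {i Vector.∷ ρ} (λ { refl → refl }) s′
      λ l m″ own others → cong₂ _+_ own (cong₂ _*_ (others (value , i ∷ []) λ _ ())
        (cong₂ _+_ own (others (basis , i ∷ l ∷ []) λ _ ()))))

    next : ∀ i s′ → P (toℕ i) (proj₁ s′) → P (suc (toℕ i)) (proj₁ (exec considerRow (i Vector.∷ ρ) s′))
    next i s′ (V-same , value-same , partial) =
      (λ k l → trans (frame basis considerRow {i Vector.∷ ρ} {s′} refl (k ∷ l ∷ [])) (V-same k l)) ,
      (λ k → trans (frame value considerRow {i Vector.∷ ρ} {s′} refl (k ∷ [])) (value-same k)) ,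
      extend (dot f (V i)) refl partial
      where
      m = proj₁ s′
      w = pivotOf m
      w′ = pivotOf (proj₁ (exec considerRow (i Vector.∷ ρ) s′))
      w′-def : ∀ l → w′ l ≡ w l + dot f (V i) * (w l + V i l)
      w′-def l = trans (update i s′ l)
        (cong₂ (λ x y → w l + x * (w l + y)) (value-same i) (V-same i l))

      extend : ∀ b → dot f (V i) ≡ b → Partial (toℕ i) w → Partial (suc (toℕ i)) w′
      extend true fi _ = inj₂ (i , fi , λ l → trans (w′-def l)
        (trans (cong (λ x → w l + x * (w l + V i l)) fi)
               (solve 2 (λ x y → x :+ (x :+ y) := y) refl (w l) (V i l))))
      extend false fi (inj₂ (k , fk , w≗V)) = inj₂ (k , fk , λ l → trans (w′-def l)
        (trans (cong (λ x → w l + x * (w l + V i l)) fi) (trans (xor-identityʳ (w l)) (w≗V l))))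
      extend false fi (inj₁ zeros) = inj₁ λ k k≤i → earlier k (k ≟ i) k≤i
        where
        earlier : ∀ k → Dec (k ≡ i) → toℕ k ℕ.< suc (toℕ i) → dot f (V k) ≡ 0#
        earlier k (yes refl) _   = fi
        earlier k (no k≢i)   k≤i = zeros k (ℕₚ.≤∧≢⇒< (ℕ.s≤s⁻¹ k≤i) (k≢i ∘ toℕ-injective))

    finish : P n (proj₁ (exec choosePivot ρ s)) → IsPivot f V (pivotOf (proj₁ (exec choosePivot ρ s)))
    finish (_ , _ , inj₁ zeros) = inj₁ λ k → zeros k (toℕ<n k)
    finish (_ , _ , inj₂ found) = inj₂ found

  computeResidue-spec : ∀ (ρ : Env (2 ℕ.+ k)) s → Ready (proj₁ s) →
                        residueOf (proj₁ (exec computeResidue ρ s))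
                          ≡ residual (pointOf (proj₁ s)) (ρ 1F) (ρ 0F)
  computeResidue-spec ρ s ready = trans
    (proj₁ (for-sum {x = residue} [] pointValue {ρ} {[]} (λ _ → refl) refl (exec startResidue ρ s)))
    (cong₂ _+_ (trans (write-here {p = residue , []} _ (proj₁ s) refl)
                      (cong₂ _+_ (Γ-ready ready (ρ 1F) (ρ 0F)) (Γ′-ready ready (ρ 1F) (ρ 0F))))
      (sum-cong-≗ λ l → cong₂ _*_ (coefficientE-eval 2F 1F 0F (l Vector.∷ ρ) (proj₁ (exec startResidue ρ s))
                                     (ready-preserved startResidue {ρ} {s} refl ready))
                                  (frame point startResidue {ρ} {s} refl (l ∷ []))))

  movePoint-spec : ∀ (ρ : Env k) s l → let m = proj₁ s in
                   pointOf (proj₁ (exec movePoint ρ s)) l ≡ pointOf m l + residueOf m * pivotOf m l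
  movePoint-spec ρ s = proj₂ (for-assign (point , 0F ∷ []) movedPoint {ρ} (λ { refl → refl }) s
    λ l m″ own others → cong₂ _+_ own (cong₂ _*_ (others (residue , []) λ _ ()) (others (pivot , l ∷ []) λ _ ())))

  moveBasis-spec : ∀ (ρ : Env k) s k l → let m = proj₁ s in
                   basisOf (proj₁ (exec moveBasis ρ s)) k l ≡ basisOf m k l + valueOf m k * pivotOf m l
  moveBasis-spec ρ s = proj₂ (for-each moveRow {ρ} {s}
    (λ m → (∀ k → valueOf m k ≡ valueOf (proj₁ s) k) × (∀ l → pivotOf m l ≡ pivotOf (proj₁ s) l))
    (λ b k m → ∀ l → basisOf m k l ≡ (if b then target k l else basisOf (proj₁ s) k l))
    ((λ _ → refl) , λ _ → refl) (λ _ _ → refl)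
    λ i s′ (value-same , pivot-same) own →
      let elsewhere , updated = for-assign (basis , 1F ∷ 0F ∷ []) movedBasis {i Vector.∷ ρ} (λ { refl → refl }) s′
            λ l m″ own others → cong₂ _+_ own
              (cong₂ _*_ (others (value , i ∷ []) λ _ ()) (others (pivot , l ∷ []) λ _ ()))
      in ((λ k → trans (frame value moveRow {i Vector.∷ ρ} {s′} refl (k ∷ [])) (value-same k)) ,
          (λ l → trans (frame pivot moveRow {i Vector.∷ ρ} {s′} refl (l ∷ [])) (pivot-same l))) ,
         (λ l → trans (updated l) (cong₂ _+_ (own l) (cong₂ _*_ (value-same i) (pivot-same l)))) ,
         λ b j j≢i same l → trans (elsewhere (basis , j ∷ l ∷ []) λ { _ refl → j≢i refl }) (same l))
    where
    target : Matrix n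
    target k l = basisOf (proj₁ s) k l + valueOf (proj₁ s) k * pivotOf (proj₁ s) l

  -- Interface between program and algebra: what `kills-new`, `kills-preserved` and
  -- `fixes-preserved` require for one equation.
  record Eliminated (i j : Fin n) (m m′ : Memory) : Set where
    field
      direction   : Vector 𝔽₂ n
      isPivot     : IsPivot (coefficient G G′ i j) (basisOf m) direction
      basis-moved : ∀ k l → basisOf m′ k l ≡ basisOf m k l + dot (coefficient G G′ i j) (basisOf m k) * direction l
      point-moved : ∀ l → pointOf m′ l ≡ pointOf m l + residual (pointOf m) i j * direction l

  open Eliminated

  -- Chains the five phases; `frame` carries each array past the phases that do not write it, so
  -- residue and multipliers refer to the state before the pass.
  eliminate-spec : ∀ (ρ : Env (2 ℕ.+ k)) s → Ready (proj₁ s) →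
                   Eliminated (ρ 1F) (ρ 0F) (proj₁ s) (proj₁ (exec eliminate ρ s))
  eliminate-spec ρ s ready = record
    { direction   = w
    ; isPivot     = subst-pivot (choosePivot-spec ρ s₁ f value₁)
    ; basis-moved = λ k l → trans (moveBasis-spec ρ s₄ k l) (cong₂ _+_
        (trans (frame basis movePoint {ρ} {s₃} refl (k ∷ l ∷ [])) (trans (frame basis computeResidue {ρ} {s₂} refl (k ∷ l ∷ []))
          (trans (frame basis choosePivot {ρ} {s₁} refl (k ∷ l ∷ [])) (basis₁ k l))))
        (cong₂ _*_
          (trans (frame value movePoint {ρ} {s₃} refl (k ∷ [])) (trans (frame value computeResidue {ρ} {s₂} refl (k ∷ []))
            (trans (frame value choosePivot {ρ} {s₁} refl (k ∷ [])) (evaluate-spec ρ s ready k))))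
          (trans (frame pivot movePoint {ρ} {s₃} refl (l ∷ [])) (frame pivot computeResidue {ρ} {s₂} refl (l ∷ [])))))
    ; point-moved = λ l → trans (frame point moveBasis {ρ} {s₄} refl (l ∷ [])) (trans (movePoint-spec ρ s₃ l) (cong₂ _+_
        (trans (frame point computeResidue {ρ} {s₂} refl (l ∷ [])) (point₂ l))
        (cong₂ _*_ residue₃ (frame pivot computeResidue {ρ} {s₂} refl (l ∷ [])))))
    }
    where
    f  = coefficient G G′ (ρ 1F) (ρ 0F)
    s₁ = exec evaluate ρ s
    s₂ = exec choosePivot ρ s₁
    s₃ = exec computeResidue ρ s₂
    s₄ = exec movePoint ρ s₃
    w  = pivotOf (proj₁ s₂)

    basis₁ : ∀ k l → basisOf (proj₁ s₁) k l ≡ basisOf (proj₁ s) k l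
    basis₁ k l = frame basis evaluate {ρ} {s} refl (k ∷ l ∷ [])

    value₁ : ∀ k → valueOf (proj₁ s₁) k ≡ dot f (basisOf (proj₁ s₁) k)
    value₁ k = trans (evaluate-spec ρ s ready k) (dot-cong f (λ l → sym (basis₁ k l)))

    point₂ : ∀ l → pointOf (proj₁ s₂) l ≡ pointOf (proj₁ s) l
    point₂ l = trans (frame point choosePivot {ρ} {s₁} refl (l ∷ [])) (frame point evaluate {ρ} {s} refl (l ∷ []))

    residue₃ : residueOf (proj₁ s₃) ≡ residual (pointOf (proj₁ s)) (ρ 1F) (ρ 0F)
    residue₃ = trans
      (computeResidue-spec ρ s₂ (ready-preserved choosePivot {ρ} {s₁} refl (ready-preserved evaluate {ρ} {s} refl ready)))
      (cong (adj G (ρ 1F) (ρ 0F) + adj G′ (ρ 1F) (ρ 0F) +_) (dot-cong f point₂))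

    subst-pivot : IsPivot f (basisOf (proj₁ s₁)) w → IsPivot f (basisOf (proj₁ s)) w
    subst-pivot (inj₁ kills) = inj₁ λ k → trans (dot-cong f (λ l → sym (basis₁ k l))) (kills k)
    subst-pivot (inj₂ (k , fk , w≗V)) =
      inj₂ (k , trans (dot-cong f (λ l → sym (basis₁ k l))) fk , λ l → trans (w≗V l) (basis₁ k l))

  -- `a` is an arbitrary solution, unknown to the program, and `Fixes` is the invariant. Each pass
  -- makes its own coefficient vector kill the basis, and later passes keep this.
  eliminate-all : ∀ {a} → Exchanges a G G′ → ∀ (ρ : Env k) s → Ready (proj₁ s) →
                  Fixes a (pointOf (proj₁ s)) (basisOf (proj₁ s)) →
                  let m = proj₁ (exec (for (for eliminate)) ρ s) in
                  Fixes a (pointOf m) (basisOf m) × (∀ i j → Kills (coefficient G G′ i j) (basisOf m))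
  eliminate-all {a = a} e ρ s ready h =
    let (_ , h′) , kills = for-establishes (for eliminate) {ρ} {s} R
          (λ i m → ∀ j → Kills (coefficient G G′ i j) (basisOf m)) (ready , h) outer
    in h′ , kills
    where
    R : Memory → Set
    R m = Ready m × Fixes a (pointOf m) (basisOf m)

    inner : ∀ i (ρ : Env _) j s → let s′ = exec eliminate (j Vector.∷ i Vector.∷ ρ) s in
            R (proj₁ s) → R (proj₁ s′) × Kills (coefficient G G′ i j) (basisOf (proj₁ s′))
              × (∀ g → Kills g (basisOf (proj₁ s)) → Kills g (basisOf (proj₁ s′)))
    inner i ρ j s (ready , h) =
      (ready-preserved eliminate {j Vector.∷ i Vector.∷ ρ} {s} refl ready ,
       fixes-preserved {w = direction x} (solves e i j) (basis-moved x) (point-moved x) h) ,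
      kills-new (basis-moved x) (isPivot x) ,
      kills-preserved (basis-moved x) (isPivot x)
      where x = eliminate-spec (j Vector.∷ i Vector.∷ ρ) s ready

    outer : ∀ i s → let s′ = exec (for eliminate) (i Vector.∷ ρ) s in
            R (proj₁ s) → R (proj₁ s′) × (∀ j → Kills (coefficient G G′ i j) (basisOf (proj₁ s′)))
              × (∀ i′ → (∀ j → Kills (coefficient G G′ i′ j) (basisOf (proj₁ s))) →
                        (∀ j → Kills (coefficient G G′ i′ j) (basisOf (proj₁ s′))))
    outer i s r =
      let r′ , established = for-establishes eliminate {i Vector.∷ ρ} {s} R
            (λ j m → Kills (coefficient G G′ i j) (basisOf m)) r
            (λ j s r → let r′ , new , old = inner i ρ j s r in r′ , new , λ j′ → old (coefficient G G′ i j′))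
      -- Coefficient vectors that killed the basis before this row of equations still do so after
      -- its inner loop.
      in r′ , established , λ i′ kills j → proj₂ (for-preserves eliminate {i Vector.∷ ρ}
           (λ m → R m × Kills (coefficient G G′ i′ j) (basisOf m)) {s} (r , kills j)
           λ l s (r , kills) → let r′ , _ , old = inner i ρ l s r in r′ , old (coefficient G G′ i′ j) kills)

  verify-spec : ∀ (ρ : Env (2 ℕ.+ k)) s → Ready (proj₁ s) →
                outOf (proj₁ (exec verify ρ s))
                  ≡ outOf (proj₁ s) * (1# + residual (pointOf (proj₁ s)) (ρ 1F) (ρ 0F))
  verify-spec ρ s ready = trans
    (write-here {p = out , []} _ (proj₁ (exec computeResidue ρ s)) refl)
    (cong₂ (λ x y → x * (1# + y)) (frame out computeResidue {ρ} {s} refl []) (computeResidue-spec ρ s ready))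

  -- The final test of the point

  module Verification (p : Vector 𝔽₂ n) where

    R : Memory → Set
    R m = Ready m × (∀ l → pointOf m l ≡ p l)

    verify-preserves : (c : Cmd k) {ρ : Env k} {s : State} →
                       writes Γ c ∨ writes Γ′ c ∨ writes δ c ≡ false → writes point c ≡ false →
                       R (proj₁ s) → R (proj₁ (exec c ρ s))
    verify-preserves c {ρ} {s} eq eq′ (ready , same) =
      ready-preserved c {ρ} {s} eq ready , λ l → trans (frame point c {ρ} {s} eq′ (l ∷ [])) (same l)

    verify-out : ∀ (ρ : Env (2 ℕ.+ k)) s → R (proj₁ s) →
                 outOf (proj₁ (exec verify ρ s)) ≡ outOf (proj₁ s) * (1# + residual p (ρ 1F) (ρ 0F))
    verify-out ρ s (ready , same) = trans (verify-spec ρ s ready)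
      (cong (λ x → outOf (proj₁ s) * (1# + (adj G (ρ 1F) (ρ 0F) + adj G′ (ρ 1F) (ρ 0F) + x)))
            (dot-cong (coefficient G G′ (ρ 1F) (ρ 0F)) same))

    ∧-true : ∀ {x y} → x * (1# + y) ≡ 1# → x ≡ 1# × y ≡ 0#
    ∧-true {true} {false} _ = refl , refl

    -- A product is 1 only if both factors are, so `out` never returns from 0 to 1. Each test shows
    -- that `out = 1` implies its residual is zero, and this implication survives later tests.
    verify-sound : ∀ (ρ : Env k) s → R (proj₁ s) →
                   outOf (proj₁ (exec (for (for verify)) ρ s)) ≡ 1# → ∀ i j → residual p i j ≡ 0#
    verify-sound ρ s r accepted i = proj₂ (for-establishes (for verify) {ρ} {s} R
      (λ i m → outOf m ≡ 1# → ∀ j → residual p i j ≡ 0#) r outer) i accepted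
      where
      outer : ∀ i s → let s′ = exec (for verify) (i Vector.∷ ρ) s in
              R (proj₁ s) → R (proj₁ s′) × (outOf (proj₁ s′) ≡ 1# → ∀ j → residual p i j ≡ 0#)
                × (∀ i′ → (outOf (proj₁ s) ≡ 1# → ∀ j → residual p i′ j ≡ 0#) →
                          (outOf (proj₁ s′) ≡ 1# → ∀ j → residual p i′ j ≡ 0#))
      outer i s r =
        let r′ , zero-row = for-establishes verify {i Vector.∷ ρ} {s} R
              (λ j m → outOf m ≡ 1# → residual p i j ≡ 0#) r
              (λ j s r → let ρ′ = j Vector.∷ i Vector.∷ ρ in
                 verify-preserves verify {ρ′} {s} refl refl r ,
                 (λ one → proj₂ (∧-true (trans (sym (verify-out ρ′ s r)) one))) ,
                 λ _ known one → known (proj₁ (∧-true (trans (sym (verify-out ρ′ s r)) one))))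
            -- `out = 1` after a row of tests forces `out = 1` before it.
            _ , monotone = for-preserves verify {i Vector.∷ ρ}
              (λ m → R m × (outOf m ≡ 1# → outOf (proj₁ s) ≡ 1#)) {s} (r , id)
              (λ j s (r , known) → let ρ′ = j Vector.∷ i Vector.∷ ρ in
                 verify-preserves verify {ρ′} {s} refl refl r ,
                 λ one → known (proj₁ (∧-true (trans (sym (verify-out ρ′ s r)) one))))
        in r′ , (λ one j → zero-row j one) , λ _ known one → known (monotone one)

    verify-complete : ∀ (ρ : Env k) s → R (proj₁ s) → outOf (proj₁ s) ≡ 1# →
                      (∀ i j → residual p i j ≡ 0#) →
                      outOf (proj₁ (exec (for (for verify)) ρ s)) ≡ 1#
    verify-complete ρ s r one zeros = proj₂ (for-preserves (for verify) {ρ} P {s} (r , one) λ i s pr →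
      for-preserves verify {i Vector.∷ ρ} P {s} pr λ j s (r , one) →
        let ρ′ = j Vector.∷ i Vector.∷ ρ in
        verify-preserves verify {ρ′} {s} refl refl r ,
        trans (verify-out ρ′ s r) (cong₂ (λ x y → x * (1# + y)) one (zeros i j)))
      where
      P : Memory → Set
      P m = R m × outOf m ≡ 1#

  residual-zero⇒exchanges : ∀ {p} → (∀ i j → residual p i j ≡ 0#) → Exchanges p G G′
  residual-zero⇒exchanges zeros .solves i j = sym (x+y≡0⇒x≡y _ _ (zeros i j))

  -- Soundness and completeness of the decision program

  s₀ s₁ s₂ s₃ : State
  s₀ = initial G G′ , 0
  s₁ = exec initialize Vector.[] s₀
  s₂ = exec (for (for eliminate)) Vector.[] s₁
  s₃ = exec ((out , []) ≔ lit 1#) Vector.[] s₂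

  initialize-spec : Ready (proj₁ s₁) × basisOf (proj₁ s₁) ≋ I
  initialize-spec = record
      { Γ-ready  = λ i j → frame Γ  initialize {Vector.[]} {s₀} refl (i ∷ j ∷ [])
      ; Γ′-ready = λ i j → frame Γ′ initialize {Vector.[]} {s₀} refl (i ∷ j ∷ [])
      ; δ-ready  = λ i → proj₁ (rows i)
      } , λ i → proj₂ (rows i)
    where
    -- In both arrays, row i is zero before iteration i and a row of the identity afterwards.
    Row : Bool → Fin n → Memory → Set
    Row b i m = (∀ j → m (δ , i ∷ j ∷ []) ≡ (if b then I i j else 0#))
              × (∀ j → basisOf m i j ≡ (if b then I i j else 0#))

    set-diagonal : ∀ x i m → (∀ j → m (x , i ∷ j ∷ []) ≡ 0#) →
                   ∀ j → write (x , i ∷ i ∷ []) 1# m (x , i ∷ j ∷ []) ≡ I i j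
    set-diagonal x i m zeros j with i ≟ j
    ... | yes refl = write-here {p = x , i ∷ i ∷ []} 1# m refl
    ... | no  i≢j  = trans (write-elsewhere {p = x , i ∷ i ∷ []} {x , i ∷ j ∷ []} 1# m λ { refl → i≢j refl }) (zeros j)

    keep : ∀ x i i′ j m → i′ ≢ i → write (x , i ∷ i ∷ []) 1# m (x , i′ ∷ j ∷ []) ≡ m (x , i′ ∷ j ∷ [])
    keep x i i′ j m i′≢i =
      write-elsewhere {p = x , i ∷ i ∷ []} {x , i′ ∷ j ∷ []} 1# m λ { refl → i′≢i refl }

    rows : ∀ i → Row true i (proj₁ s₁)
    rows = proj₂ (for-each initializeRow {Vector.[]} {s₀} (λ _ → ⊤) Row tt (λ _ → (λ _ → refl) , λ _ → refl)
      λ i s _ (δ-row , V-row) → let s′ = exec ((δ , 0F ∷ 0F ∷ []) ≔ lit 1#) (i Vector.∷ Vector.[]) s in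
        tt ,
        (set-diagonal δ i (proj₁ s) δ-row , set-diagonal basis i (proj₁ s′) V-row) ,
        λ b i′ i′≢i (δ-row , V-row) →
          (λ j → trans (keep δ i i′ j (proj₁ s) i′≢i) (δ-row j)) ,
          (λ j → trans (keep basis i i′ j (proj₁ s′) i′≢i) (V-row j)))

  ready₃ : Ready (proj₁ s₃)
  ready₃ = ready-preserved {0} ((out , []) ≔ lit 1#) {Vector.[]} {s₂} refl
             (ready-preserved (for (for eliminate)) {Vector.[]} {s₁} refl (proj₁ initialize-spec))

  point₃ : ∀ l → pointOf (proj₁ s₃) l ≡ pointOf (proj₁ s₂) l
  point₃ l = frame {0} point ((out , []) ≔ lit 1#) {Vector.[]} {s₂} refl (l ∷ [])

  open Verification (pointOf (proj₁ s₂))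

  decide-sound : output n decide G G′ ≡ 1# → EdgeLocallyEquivalent G G′
  decide-sound accepted = exchanges⇒equivalent (residual-zero⇒exchanges
    (verify-sound Vector.[] s₃ (ready₃ , point₃) accepted))

  -- All coefficient vectors kill the final basis, so the final point has the same value as the
  -- solution `a` in every equation.
  residual-zero : ∀ {a} → Exchanges a G G′ → ∀ i j → residual (pointOf (proj₁ s₂)) i j ≡ 0#
  residual-zero {a} e i j = trans
    (cong (adj G i j + adj G′ i j +_)
      (trans (fixes-killed (proj₁ eliminated) (coefficient G G′ i j) (proj₂ eliminated i j)) (solves e i j)))
    (xor-same (adj G i j + adj G′ i j))
    where
    eliminated : Fixes a (pointOf (proj₁ s₂)) (basisOf (proj₁ s₂))
                 × (∀ i j → Kills (coefficient G G′ i j) (basisOf (proj₁ s₂)))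
    eliminated = eliminate-all e Vector.[] s₁ (proj₁ initialize-spec)
      (fixes-init (λ l → frame point initialize {Vector.[]} {s₀} refl (l ∷ [])) (proj₂ initialize-spec))

  decide-complete : EdgeLocallyEquivalent G G′ → output n decide G G′ ≡ 1#
  decide-complete equivalent = verify-complete Vector.[] s₃ (ready₃ , point₃)
    (write-here {p = out , []} 1# (proj₁ s₂) refl) (residual-zero (proj₂ (equivalent⇒exchanges equivalent)))

-- The time bound and the theorem

-- The weight depends on the program text alone, so its value at 1 serves as the constant for all n.
weight-decide : ∀ n .{{_ : NonZero n}} → RunningTime.weight n decide ≡ RunningTime.weight 1 decide
weight-decide n = refl

-- Two loops over the equations enclose two loops over a basis vector and its entries.
depth-decide : depth decide ≡ 4
depth-decide = refl

decide-time : ∀ n → 1 ≤ n → ∀ (G G′ : Graph n) →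
              time n decide G G′ ≤ RunningTime.weight 1 decide ℕ.* n ^ 4
decide-time n 1≤n G G′ = ℕₚ.≤-trans
  (RunningTime.exec-time n decide Vector.[] (Semantics.initial n G G′ , 0))
  (ℕₚ.≤-reflexive (cong₂ (λ w d → w ℕ.* n ^ d) (weight-decide n) depth-decide))
  where instance _ = ℕ.>-nonZero 1≤n

mainTheorem2 : (∀ (n : ℕ) (G G′ : Graph n) →
    (EdgeLocallyEquivalent G G′ ⇔
    (∃[ A ] (IsDiagonal A
    × ((adj G′ ⊞ I) ⊠ A ⊠ (adj G ⊞ I) ≋ adj G ⊞ adj G′))))
    × (∀ i j → IsAffine (λ a →
    ((adj G′ ⊞ I) ⊠ diag a ⊠ (adj G ⊞ I)) i j + (adj G ⊞ adj G′) i j)))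
    × DecidableInTimeO EdgeLocallyEquivalent (λ n → n ^ 4)
mainTheorem2 =
  (λ n G G′ →
    mk⇔ (λ equivalent → let a , e = equivalent⇒exchanges equivalent in
           diag a , diag-isDiagonal a , exchanges⇒matrix e)
        (λ (A , A-diagonal , eq) → exchanges⇒equivalent (matrix⇒exchanges {A = A} {G} {G′} A-diagonal eq)) ,
    -- The left side is linear in `a` by `⊠-diag`; the entry of Γ + Γ′ is the constant term.
    λ i j → coefficient G G′ i j , adj G i j + adj G′ i j , λ a →
      cong (_+ (adj G i j + adj G′ i j)) (⊠-diag (adj G′ ⊞ I) (adj G ⊞ I) a i j)) ,
  decide ,
  (λ n G G′ → mk⇔ (Correctness.decide-sound G G′) (Correctness.decide-complete G G′)) ,
  -- The threshold is 1, because the right side of the bound is 0 at n = 0.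
  RunningTime.weight 1 decide , 1 , decide-time
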